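{- Let $q$ be a square-free positive integer with $(q, 14) = 1$. Let $f_1, f_2, \ldots, f_9$ be nine real-valued functions on $\mathbb{Z}_q^{(3)}$. Then, for any $n \in \mathbb{Z}_q$, there exist $x_1, x_2, \ldots, x_9 \in \mathbb{Z}_q^{(3)}$ such that $n = x_1 + x_2 + \cdots + x_9$ in $\mathbb{Z}_q$ and $$\sum_{i=1}^9 f_i(x_i)\geq\frac{1}{\phi_3(q)}\sum_{a\in \mathbb{Z}_q^{(3)}}\sum_{i=1}^9 f_i(a).$$
   Context: For a positive integer $q$, $\mathbb{Z}_q=\mathbb{Z}/q\mathbb{Z}$ and $\mathbb{Z}_q^{\ast}=\{b\in\mathbb{Z}_q:(b,q)=1\}$. $\mathbb{Z}_q^{(3)}$ denotes the set of cubic residues in $\mathbb{Z}_q^\ast$, i.e. $\mathbb{Z}_q^{(3)}=\{x^3 : x\in\mathbb{Z}_q^\ast\}$, and $\phi_3(q)=|\mathbb{Z}_q^{(3)}|$. -}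

module Defs where

open import Algebra.Bundles.Raw using (RawMonoid)
import Algebra.Definitions.RawMonoid as MonoidSum
open import Data.Fin.Base using (Fin; toℕ)
open import Data.Fin.Properties using (any?; _≟_; toℕ-fromℕ<)
open import Data.Irrelevant using ([_])
open import Data.List.Base using (List; _∷_; allFin; mapMaybe; length)
open import Data.List.Membership.Propositional using (_∈_)
open import Data.List.Membership.Propositional.Properties using (∈-allFin)
open import Data.List.Relation.Unary.Any using (here; there)
open import Data.Maybe.Base as Maybe using (Maybe)
open import Data.Nat.Base as ℕ using (ℕ; NonZero)
open import Data.Nat.Coprimality using (Coprime; coprime?)
open import Data.Nat.Divisibility using (_∣_; ∣1⇒≡1; ∣n∣m%n⇒∣m)
open import Data.Nat.DivMod using (_mod_; m%n<n)
import Data.Nat.Properties as ℕ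
open import Data.Product.Base using (_×_; _,_; proj₁; proj₂; ∃-syntax)
open import Data.Rational.Base as ℚ using (ℚ; 0ℚ; 1ℚ; ½; ∣_∣)
import Data.Rational.Properties as ℚ
open import Data.Rational.Solver using (module +-*-Solver)
open import Data.Refinement.Base using (Refinement-syntax; _,_)
open import Data.Vec.Functional using (Vector; fromList)
open import Level using (0ℓ)
open import Relation.Binary.PropositionalEquality
  using (_≡_; refl; sym; cong; subst)
open import Relation.Nullary.Decidable.Core using (Dec; yes; no; _×-dec_; dec⇒maybe; recompute)

SquareFree : ℕ → Set
SquareFree q = ∀ d → d ℕ.* d ∣ q → d ≡ 1

-- Residue classes are given by their representatives 0, …, q - 1.
ℤ/_ : ℕ → Set
ℤ/ q = Fin q

module _ {q : ℕ} .{{_ : NonZero q}} where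

  infixl 6 _+ₘ_
  infixl 7 _*ₘ_

  _+ₘ_ _*ₘ_ : ℤ/ q → ℤ/ q → ℤ/ q
  a +ₘ b = (toℕ a ℕ.+ toℕ b) mod q
  a *ₘ b = (toℕ a ℕ.* toℕ b) mod q

  0ₘ : ℤ/ q
  0ₘ = 0 mod q

  ℤ/-+-rawMonoid : RawMonoid 0ℓ 0ℓ
  ℤ/-+-rawMonoid = record { Carrier = ℤ/ q ; _≈_ = _≡_ ; _∙_ = _+ₘ_ ; ε = 0ₘ }

  sumₘ : ∀ {k} → Vector (ℤ/ q) k → ℤ/ q
  sumₘ = MonoidSum.sum ℤ/-+-rawMonoid

  IsUnit : ℤ/ q → Set
  IsUnit a = Coprime (toℕ a) q

  IsCubicResidue : ℤ/ q → Set
  IsCubicResidue a = ∃[ x ] IsUnit x × x *ₘ x *ₘ x ≡ a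

  isCubicResidue? : ∀ a → Dec (IsCubicResidue a)
  isCubicResidue? a =
    any? λ x → coprime? (toℕ x) q ×-dec (x *ₘ x *ₘ x ≟ a)

-- The membership proof is irrelevant, so elements of this type are equal as
-- soon as the underlying residue classes are.
ℤ/_⁽³⁾ : (q : ℕ) .{{_ : NonZero q}} → Set
ℤ/ q ⁽³⁾ = [ a ∈ ℤ/ q ∣ IsCubicResidue a ]

module _ (q : ℕ) .{{_ : NonZero q}} where

  toCubicResidue : ℤ/ q → Maybe (ℤ/ q ⁽³⁾)
  toCubicResidue a = Maybe.map (λ p → a , [ p ]) (dec⇒maybe (isCubicResidue? a))

  -- Every cubic residue modulo q, listed exactly once.
  cubicResidues : List (ℤ/ q ⁽³⁾)
  cubicResidues = mapMaybe toCubicResidue (allFin q)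

  φ₃ : ℕ
  φ₃ = length cubicResidues

  ∈-cubicResidues : (c : ℤ/ q ⁽³⁾) → c ∈ cubicResidues
  ∈-cubicResidues c@(a , [ p ]) = go (allFin q) (∈-allFin a)
    where
    go : ∀ as → a ∈ as → c ∈ mapMaybe toCubicResidue as
    go (b ∷ as) (here refl) with isCubicResidue? a
    ... | yes _ = here refl
    ... | no ¬p with () ← ¬p (recompute (isCubicResidue? a) p)
    go (b ∷ as) (there a∈as) with isCubicResidue? b
    ... | yes _ = there (go as a∈as)
    ... | no _  = go as a∈as

  private
    1ₘ : ℤ/ q
    1ₘ = 1 mod q

    1ₘ-isUnit : IsUnit 1ₘ
    1ₘ-isUnit (d∣1 , d∣q) =
      ∣1⇒≡1 (∣n∣m%n⇒∣m d∣q (subst (_ ∣_) (toℕ-fromℕ< (m%n<n 1 q)) d∣1))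

  φ₃-nonZero : NonZero φ₃
  φ₃-nonZero = nonEmpty (∈-cubicResidues (1ₘ *ₘ 1ₘ *ₘ 1ₘ , [ 1ₘ , 1ₘ-isUnit , refl ]))
    where
    nonEmpty : ∀ {A : Set} {x : A} {xs} → x ∈ xs → NonZero (length xs)
    nonEmpty (here _)  = _
    nonEmpty (there _) = _

-- Cauchy sequences of rationals. Two sequences x and y denote the same real
-- number when x ≤ᴿ y and y ≤ᴿ x.
record ℝ : Set where
  field
    seq    : ℕ → ℚ
    cauchy : ∀ ε → 0ℚ ℚ.< ε →
             ∃[ N ] ∀ m n → N ℕ.≤ m → N ℕ.≤ n → ∣ seq m ℚ.- seq n ∣ ℚ.< ε
open ℝ public

infix  4 _≤ᴿ_ _≥ᴿ_ _≈ᴿ_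
infixl 6 _+ᴿ_
infixr 7 _·ᴿ_

_≤ᴿ_ _≥ᴿ_ _≈ᴿ_ : ℝ → ℝ → Set
x ≤ᴿ y = ∀ ε → 0ℚ ℚ.< ε → ∃[ N ] ∀ n → N ℕ.≤ n → seq x n ℚ.≤ seq y n ℚ.+ ε
x ≥ᴿ y = y ≤ᴿ x
x ≈ᴿ y = x ≤ᴿ y × y ≤ᴿ x

0ᴿ : ℝ
0ᴿ = record { seq = λ _ → 0ℚ ; cauchy = λ _ 0<ε → 0 , λ _ _ _ _ → 0<ε }

private
  open +-*-Solver using (solve; _:=_; _:+_; _:-_; _:*_; con)

  interchange : ∀ a b c d → (a ℚ.+ b) ℚ.- (c ℚ.+ d) ≡ (a ℚ.- c) ℚ.+ (b ℚ.- d)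
  interchange = solve 4 (λ a b c d → (a :+ b) :- (c :+ d) := (a :- c) :+ (b :- d)) refl

  halves : ∀ ε → ½ ℚ.* ε ℚ.+ ½ ℚ.* ε ≡ ε
  halves = solve 1 (λ ε → con ½ :* ε :+ con ½ :* ε := ε) refl

  factor : ∀ r a b → r ℚ.* a ℚ.- r ℚ.* b ≡ r ℚ.* (a ℚ.- b)
  factor = solve 3 (λ r a b → r :* a :- r :* b := r :* (a :- b)) refl

  0<* : ∀ r .{{_ : ℚ.Positive r}} {ε} → 0ℚ ℚ.< ε → 0ℚ ℚ.< r ℚ.* ε
  0<* r 0<ε = subst (ℚ._< r ℚ.* _) (ℚ.*-zeroʳ r) (ℚ.*-monoʳ-<-pos r 0<ε)

_+ᴿ_ : ℝ → ℝ → ℝ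
x +ᴿ y = record { seq = λ n → seq x n ℚ.+ seq y n ; cauchy = cauchy′ }
  where
  cauchy′ : ∀ ε → 0ℚ ℚ.< ε → ∃[ N ] ∀ m n → N ℕ.≤ m → N ℕ.≤ n →
            ∣ (seq x m ℚ.+ seq y m) ℚ.- (seq x n ℚ.+ seq y n) ∣ ℚ.< ε
  cauchy′ ε 0<ε = N₁ ℕ.⊔ N₂ , λ m n N≤m N≤n → begin-strict
    ∣ (seq x m ℚ.+ seq y m) ℚ.- (seq x n ℚ.+ seq y n) ∣
      ≡⟨ cong ∣_∣ (interchange (seq x m) (seq y m) (seq x n) (seq y n)) ⟩
    ∣ (seq x m ℚ.- seq x n) ℚ.+ (seq y m ℚ.- seq y n) ∣
      ≤⟨ ℚ.∣p+q∣≤∣p∣+∣q∣ (seq x m ℚ.- seq x n) (seq y m ℚ.- seq y n) ⟩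
    ∣ seq x m ℚ.- seq x n ∣ ℚ.+ ∣ seq y m ℚ.- seq y n ∣
      <⟨ ℚ.+-mono-<
           (proj₂ cx m n (ℕ.m⊔n≤o⇒m≤o N₁ N₂ N≤m) (ℕ.m⊔n≤o⇒m≤o N₁ N₂ N≤n))
           (proj₂ cy m n (ℕ.m⊔n≤o⇒n≤o N₁ N₂ N≤m) (ℕ.m⊔n≤o⇒n≤o N₁ N₂ N≤n)) ⟩
    ½ ℚ.* ε ℚ.+ ½ ℚ.* ε
      ≡⟨ halves ε ⟩
    ε ∎
    where
    open ℚ.≤-Reasoning
    cx = cauchy x (½ ℚ.* ε) (0<* ½ 0<ε)
    cy = cauchy y (½ ℚ.* ε) (0<* ½ 0<ε)
    N₁ = proj₁ cx
    N₂ = proj₁ cy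

_·ᴿ_ : ℚ → ℝ → ℝ
r ·ᴿ x = record { seq = λ n → r ℚ.* seq x n ; cauchy = cauchy′ }
  where
  s = 1ℚ ℚ.+ ∣ r ∣

  0<s : 0ℚ ℚ.< s
  0<s = ℚ.+-mono-<-≤ {0ℚ} {1ℚ} {0ℚ} {∣ r ∣} (ℚ.positive⁻¹ 1ℚ) (ℚ.0≤∣p∣ r)

  ∣r∣≤s : ∣ r ∣ ℚ.≤ s
  ∣r∣≤s = subst (ℚ._≤ s) (ℚ.+-identityˡ ∣ r ∣)
            (ℚ.+-monoˡ-≤ ∣ r ∣ (ℚ.<⇒≤ (ℚ.positive⁻¹ 1ℚ)))

  instance
    s-positive : ℚ.Positive s
    s-positive = ℚ.positive 0<s

    s-nonZero : ℚ.NonZero s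
    s-nonZero = ℚ.pos⇒nonZero s

  cauchy′ : ∀ ε → 0ℚ ℚ.< ε → ∃[ N ] ∀ m n → N ℕ.≤ m → N ℕ.≤ n →
            ∣ r ℚ.* seq x m ℚ.- r ℚ.* seq x n ∣ ℚ.< ε
  cauchy′ ε 0<ε = proj₁ cx , λ m n N≤m N≤n → begin-strict
    ∣ r ℚ.* seq x m ℚ.- r ℚ.* seq x n ∣
      ≡⟨ cong ∣_∣ (factor r (seq x m) (seq x n)) ⟩
    ∣ r ℚ.* (seq x m ℚ.- seq x n) ∣
      ≡⟨ ℚ.∣p*q∣≡∣p∣*∣q∣ r (seq x m ℚ.- seq x n) ⟩
    ∣ r ∣ ℚ.* ∣ seq x m ℚ.- seq x n ∣
      ≤⟨ ℚ.*-monoʳ-≤-nonNeg ∣ seq x m ℚ.- seq x n ∣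
           {{ℚ.nonNegative (ℚ.0≤∣p∣ (seq x m ℚ.- seq x n))}} ∣r∣≤s ⟩
    s ℚ.* ∣ seq x m ℚ.- seq x n ∣
      <⟨ ℚ.*-monoʳ-<-pos s (proj₂ cx m n N≤m N≤n) ⟩
    s ℚ.* (ℚ.1/ s ℚ.* ε)
      ≡⟨ sym (ℚ.*-assoc s (ℚ.1/ s) ε) ⟩
    s ℚ.* ℚ.1/ s ℚ.* ε
      ≡⟨ cong (ℚ._* ε) (ℚ.*-inverseʳ s) ⟩
    1ℚ ℚ.* ε
      ≡⟨ ℚ.*-identityˡ ε ⟩
    ε ∎
    where
    open ℚ.≤-Reasoning
    cx = cauchy x (ℚ.1/ s ℚ.* ε)
           (0<* (ℚ.1/ s) {{ℚ.1/pos⇒pos s}} 0<ε)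

ℝ-+-rawMonoid : RawMonoid 0ℓ 0ℓ
ℝ-+-rawMonoid = record { Carrier = ℝ ; _≈_ = _≈ᴿ_ ; _∙_ = _+ᴿ_ ; ε = 0ᴿ }

sumᴿ : ∀ {k} → Vector ℝ k → ℝ
sumᴿ = MonoidSum.sum ℝ-+-rawMonoid

∑⁽³⁾ : (q : ℕ) .{{_ : NonZero q}} → (ℤ/ q ⁽³⁾ → ℝ) → ℝ
∑⁽³⁾ q g = sumᴿ λ j → g (fromList (cubicResidues q) j)

syntax ∑⁽³⁾ q (λ a → e) = ∑[ a ∈ℤ/ q ⁽³⁾] e

{-# OPTIONS --safe #-}
module Submission where

-- The idea is to fix the sum n and to average over suitable tuples of cubic
-- residues instead of all tuples.
--
-- Let p be a prime other than 2 and 7, and let H be the set of its h cubic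
-- residues. A class has at most three cube roots (noFourCubeRoots), so that p -
-- 1 ≤ 3h. It follows that p + 3 ≤ 4h (p+3≤4φ₃), except for p = 3, where this
-- holds because h = 2. For each i list H in decreasing order of f i, and let
-- the level set of size m be the set of the first m entries. For 0 ≤ j < h take
-- the level sets of size j + 1 of the five functions f i with i even, and those
-- of size h - j of the four with i odd. Their sizes add up to 4h + 5 + j, so by
-- the Cauchy-Davenport theorem (largeIteratedSumset) their sumset has at least
-- 4h - 3 + j ≥ p elements or is everything; in both cases it contains n. This
-- gives a tuple x with sum n such that each f i (x i) is at least the value of
-- f i at the last entry of its level set. As j varies, these last entries run
-- over H exactly once for every i. The best of the h tuples therefore attains
-- the average (levelSets⇒averaging).
--
-- The property passes from p and q to p q when p and q are coprime
-- (Averaging-cartesianProduct). By the Chinese remainder theorem a cubic residue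
-- modulo p q is a pair (a , b) of cubic residues (cubicResidues-*). Apply the
-- property modulo p to the sums of f i (a , b) over b, which fixes the a i, and
-- then the property modulo q to the functions sending b to f i (a i , b). A
-- square-free q is a product of distinct primes, so induction on its prime
-- factors concludes.
--
-- Apart from the final division by φ₃ q, only addition and the total order of
-- the values of f matter. The argument therefore takes place in an ordered
-- commutative monoid, with averages multiplied by the number of terms.

open import Defs
open import Algebra.Bundles using (Group; CommutativeMonoid; CommutativeRing)
import Algebra.Consequences.Propositional as Consequences
import Algebra.Definitions.RawMonoid as RawMonoidDefinitions
import Algebra.Properties.CommutativeMonoid.Sum as FiniteSums
import Algebra.Properties.Group as GroupProperties
import Algebra.Properties.Monoid.Sum as MonoidSums
import Algebra.Solver.Ring.NaturalCoefficients.Default as NaturalSolver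
open import Algebra.Structures using (IsAbelianGroup)
open import Axiom.ExcludedMiddle using (ExcludedMiddle)
open import Data.Fin.Base using (Fin; zero; suc; toℕ; opposite)
open import Data.Fin.Permutation as Permutation using (Permutation′; _⟨$⟩ʳ_)
open import Data.Fin.Properties as Fin
  using (toℕ-fromℕ<; toℕ-injective; toℕ<n; suc-injective; opposite-prop)
open import Data.Irrelevant using ([_])
open import Data.List.Base
  using (List; []; _∷_; _++_; length; map; mapMaybe; filter; lookup; take; tabulate; allFin; cartesianProductWith)
import Data.List.Membership.DecPropositional as DecMembership
open import Data.List.Membership.Propositional using (_∈_; lose; find)
open import Data.List.Membership.Propositional.Properties
  using (∈-filter⁺; ∈-filter⁻; ∈-map⁺; ∈-map⁻; ∈-++⁻; ∈-tabulate⁻; ∈-allFin; ∈-lookup; ∈-cartesianProductWith⁺)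
open import Data.List.Membership.Propositional.Properties.WithK using (unique∧set⇒bag)
open import Data.List.Properties using (length-++; length-map; length-take; length-tabulate; filter-notAll)
open import Data.List.Relation.Binary.BagAndSetEquality using (∼bag⇒↭)
open import Data.List.Relation.Binary.Permutation.Propositional as ↭ using (_↭_; ↭⇒↭ₛ)
import Data.List.Relation.Binary.Permutation.Propositional.Properties as ↭
import Data.List.Relation.Binary.Permutation.Setoid.Properties as ↭ₛ
open import Data.List.Relation.Unary.All as All using (All; []; _∷_)
open import Data.List.Relation.Unary.AllPairs using (AllPairs; []; _∷_)
open import Data.List.Relation.Unary.Any using (here; there; any?)
import Data.List.Relation.Unary.Sorted.TotalOrder.Properties as Sorted
open import Data.List.Relation.Unary.Unique.Propositional using (Unique)
import Data.List.Relation.Unary.Unique.Propositional.Properties as Unique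
import Data.List.Sort as Sort
open import Data.Nat.Base
  using (ℕ; zero; suc; NonZero; >-nonZero⁻¹; _+_; _*_; _∸_; _⊓_; _⊔_; _≤_; _<_; z≤n; s≤s; s≤s⁻¹)
open import Data.Nat.Coprimality as Coprimality using (Coprime; coprime-Bézout; coprime-divisor; prime⇒coprime)
open import Data.Nat.DivMod
  using (_%_; _mod_; _div_; m%n<n; m<n⇒m%n≡m; %-distribˡ-+; %-distribˡ-*; [m+kn]%n≡m%n; m∣n⇒o%n%m≡o%m; m≡m%n+[m/n]*n)
open import Data.Nat.Divisibility
  using (_∣_; divides; ∣-refl; ∣-trans; ∣⇒≤; ∣1⇒≡1; n∣m⇒m%n≡0; m%n≡0⇒n∣m; ∣n∣m%n⇒∣m; %-presˡ-∣; m∣m*n; n∣m*n; ∣m⇒∣m*n; ∣n⇒∣m*n; *-monoˡ-∣; *-monoʳ-∣)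
open import Data.Nat.GCD using (module Bézout)
open import Data.Nat.ListAction using (product)
open import Data.Nat.Primality
  using (Prime; euclidsLemma; composite[4]; composite[6]; composite-∣; composite-≢; prime⇒¬composite; ¬prime[0]; ¬prime[1]; prime⇒nonZero; prime⇒irreducible; productOfPrimes≢0)
open import Data.Nat.Primality.Factorisation using (factorise; module PrimeFactorisation)
import Data.Nat.Properties as ℕ
open import Data.Nat.Solver using (module +-*-Solver)
open import Data.Product.Base using (_×_; Σ-syntax; ∃-syntax; ∃₂; _,_; proj₁; proj₂; swap)
open import Data.Refinement.Base as Refinement using (value; _,_)
open import Data.Refinement.Properties using (value-injective)
open import Data.Sum.Base as Sum using (_⊎_; inj₁; inj₂)
import Data.Vec.Functional as Vec
open import Function.Base using (_∘_)
open import Function.Bundles using (mk⇔)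
open import Level using (0ℓ)
open import Relation.Binary.Bundles using (DecTotalOrder)
import Relation.Binary.Construct.Flip.EqAndOrd as Flip
import Relation.Binary.Construct.On as On
open import Relation.Binary.Definitions using (DecidableEquality)
open import Relation.Binary.PropositionalEquality renaming (setoid to ≡-setoid)
open import Relation.Binary.Structures using (IsDecTotalOrder)
open import Relation.Nullary.Decidable using (yes; no; ¬?; decidable-stable)
open import Relation.Nullary.Negation using (¬_; contradiction)
open import Relation.Unary using (Decidable; Pred)
open import Relation.Unary.Properties using (∁?)

-- Counting with lists of distinct elements

length-filter-∁ : ∀ {A : Set} {P : Pred A 0ℓ} (P? : Decidable P) xs →
                  length (filter P? xs) + length (filter (∁? P?) xs) ≡ length xs
length-filter-∁ P? []       = refl
length-filter-∁ P? (x ∷ xs) with P? x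
... | yes _ = cong suc (length-filter-∁ P? xs)
... | no  _ = trans (ℕ.+-suc _ _) (cong suc (length-filter-∁ P? xs))

-- If every fibre of g has at most k elements, then a set which g maps into
-- ys has at most k times as many elements as ys. Induction on ys removes one
-- fibre at a time.
length-fibres : ∀ {A B : Set} (_≟_ : DecidableEquality B) (g : A → B) k →
                (∀ b vs → Unique vs → (∀ {v} → v ∈ vs → g v ≡ b) → length vs ≤ k) →
                ∀ ys xs → Unique xs → (∀ {x} → x ∈ xs → g x ∈ ys) →
                length xs ≤ length ys * k
length-fibres _≟_ g k fibre []       []       _   _   = z≤n
length-fibres _≟_ g k fibre []       (x ∷ xs) _   g∈  with () ← g∈ (here refl)
length-fibres _≟_ g k fibre (y ∷ ys) xs       xs! g∈  = begin
  length xs                                             ≡⟨ length-filter-∁ P? xs ⟨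
  length (filter P? xs) + length (filter (∁? P?) xs)    ≤⟨ ℕ.+-mono-≤ here≤ there≤ ⟩
  k + length ys * k                                     ∎
  where
  open ℕ.≤-Reasoning
  P? = λ x → g x ≟ y
  here≤ = fibre y (filter P? xs) (Unique.filter⁺ P? xs!) (proj₂ ∘ ∈-filter⁻ P? {xs = xs})
  g∈ys : ∀ {x} → x ∈ filter (∁? P?) xs → g x ∈ ys
  g∈ys x∈ with x∈xs , gx≢y ← ∈-filter⁻ (∁? P?) {xs = xs} x∈ | g∈ x∈xs
  ... | here gx≡y   = contradiction gx≡y gx≢y
  ... | there gx∈ys = gx∈ys
  there≤ = length-fibres _≟_ g k fibre ys (filter (∁? P?) xs) (Unique.filter⁺ (∁? P?) xs!) g∈ys

unique∧constant⇒length≤1 : ∀ {A : Set} (b : A) vs → Unique vs → (∀ {v} → v ∈ vs → v ≡ b) → length vs ≤ 1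
unique∧constant⇒length≤1 b []           _                   _  = z≤n
unique∧constant⇒length≤1 b (_ ∷ [])     _                   _  = s≤s z≤n
unique∧constant⇒length≤1 b (_ ∷ _ ∷ _) ((v≢w ∷ _) ∷ _) ≡b =
  contradiction (trans (≡b (here refl)) (sym (≡b (there (here refl))))) v≢w

unique∧⊆⇒length≤ : ∀ {A : Set} → DecidableEquality A → ∀ {xs ys : List A} →
                   Unique xs → (∀ {x} → x ∈ xs → x ∈ ys) → length xs ≤ length ys
unique∧⊆⇒length≤ _≟_ {xs} {ys} xs! xs⊆ys =
  subst (length xs ≤_) (ℕ.*-identityʳ _)
    (length-fibres _≟_ (λ x → x) 1 unique∧constant⇒length≤1 ys xs xs! xs⊆ys)

Unique-resp-↭ : ∀ {A : Set} {xs ys : List A} → xs ↭ ys → Unique xs → Unique ys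
Unique-resp-↭ p = ↭ₛ.Unique-resp-↭ (≡-setoid _) (↭⇒↭ₛ p)

unique∧long⇒full : ∀ {n} {xs : List (Fin n)} → Unique xs → n ≤ length xs → ∀ x → x ∈ xs
unique∧long⇒full {n} {xs} xs! n≤xs x with x ∈? xs
  where open DecMembership Fin._≟_ using (_∈?_)
... | yes x∈ = x∈
... | no x∉ = contradiction
  (subst (suc (length xs) ≤_) (length-tabulate {n = n} (λ i → i))
    (unique∧⊆⇒length≤ Fin._≟_ {ys = allFin n}
      (All.tabulate (λ y∈ x≡y → x∉ (subst (_∈ xs) (sym x≡y) y∈)) ∷ xs!) (λ {y} _ → ∈-allFin y)))
  (ℕ.<⇒≱ (s≤s n≤xs))

-- The Cauchy-Davenport theorem

-- An abelian group in which every nonzero element is a generator: a property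
-- which holds for ε and is preserved by adding b holds everywhere. Finite
-- subsets are lists of distinct elements.
module CauchyDavenport
  {A : Set} {_∙_ : A → A → A} {ε : A} {_⁻¹ : A → A}
  (isAbelianGroup : IsAbelianGroup _≡_ _∙_ ε _⁻¹)
  (_≟_ : DecidableEquality A)
  (generates : ∀ b → b ≢ ε → (P : A → Set) → P ε → (∀ {x} → P x → P (x ∙ b)) → ∀ x → P x)
  where

  open IsAbelianGroup isAbelianGroup using (isGroup; assoc; comm; identityʳ; inverseˡ)
  open DecMembership _≟_ using (_∈?_)

  private
    group : Group 0ℓ 0ℓ
    group = record { isGroup = isGroup }

  open RawMonoidDefinitions (Group.rawMonoid group) using () renaming (sum to ∑)
  open GroupProperties group using (\\-leftDividesˡ) renaming (∙-cancelˡ to cancelˡ)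

  -- The list exhausts the group.
  Full : List A → Set
  Full xs = ∀ x → x ∈ xs

  -- A nonempty list of distinct elements of the sumset of as and bs, which
  -- exhausts the group or has at least |as| + |bs| - 1 elements.
  record LargeSumset (as bs : List A) : Set where
    field
      sums     : List A
      unique   : Unique sums
      nonempty : 0 < length sums
      split    : ∀ {c} → c ∈ sums → ∃₂ λ a b → a ∈ as × b ∈ bs × c ≡ a ∙ b
      large    : Full sums ⊎ length as + length bs ≤ suc (length sums)

  -- A set which is closed under translation by a nonzero element is everything.
  closed⇒full : ∀ {b a as} → b ≢ ε → a ∈ as → (∀ {x} → x ∈ as → x ∙ b ∈ as) → Full as
  closed⇒full {b} {a} {as} b≢ε a∈as +b x =
    subst (_∈ as) (\\-leftDividesˡ a x)
      (generates b b≢ε (λ y → a ∙ y ∈ as) (subst (_∈ as) (sym (identityʳ a)) a∈as)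
        (λ a∙y∈as → subst (_∈ as) (assoc _ _ _) (+b a∙y∈as)) ((a ⁻¹) ∙ x))

  -- The case ε ∈ bs, by induction on a bound n of |bs|. As long as some a ∈ as and b ∈ bs have a ∙ b ∉ as, the
  -- Dyson transform moves the elements a ∙ b outside as from the second set
  -- to the first. This keeps |as| + |bs|, and the new sumset is contained in
  -- the old one: if a ∙ y ∈ as, then (a ∙ z) ∙ y = (a ∙ y) ∙ z. If there is no
  -- such pair, then as is closed under translation by bs, so that either
  -- bs = {ε} or as is everything.
  largeSumset₀ : ∀ n as bs → length bs ≤ n → Unique as → Unique bs →
                 0 < length as → ε ∈ bs → LargeSumset as bs
  largeSumset₀ zero    as (_ ∷ _) ()
  largeSumset₀ (suc n) as@(a₀ ∷ _) bs bs≤n as! bs! 0<as ε∈bs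
    with any? (λ a → any? (λ b → ¬? ((a ∙ b) ∈? as)) bs) as
  ... | no closed = record
    { sums = as ; unique = as! ; nonempty = 0<as
    ; split = λ {c} c∈as → c , ε , c∈as , ε∈bs , sym (identityʳ c)
    ; large = large }
    where
    large : Full as ⊎ length as + length bs ≤ suc (length as)
    large with any? (λ b → ¬? (b ≟ ε)) bs
    ... | yes some with b , b∈bs , b≢ε ← find some =
      inj₁ (closed⇒full b≢ε (here refl) λ x∈as →
        decidable-stable (_ ∈? as) λ x∙b∉as → closed (lose x∈as (lose b∈bs x∙b∉as)))
    ... | no none = inj₂ (ℕ.≤-trans
      (ℕ.+-monoʳ-≤ (length as) (unique∧constant⇒length≤1 ε bs bs!
        λ b∈bs → decidable-stable (_ ≟ ε) λ b≢ε → none (lose b∈bs b≢ε)))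
      (ℕ.≤-reflexive (ℕ.+-comm (length as) 1)))
  ... | yes some with a , a∈as , some′ ← find some = record
    { sums = sums ; unique = unique ; nonempty = nonempty
    ; split = split′ ∘ split
    ; large = Sum.map₂ (subst (_≤ suc (length sums)) size) large }
    where
    P? : Decidable (λ b → a ∙ b ∈ as)
    P? b = (a ∙ b) ∈? as
    moved = filter (∁? P?) bs
    as′   = as ++ map (a ∙_) moved
    bs′   = filter P? bs

    as′! : Unique as′
    as′! = Unique.++⁺ as! (Unique.map⁺ (cancelˡ _ _ _) (Unique.filter⁺ (∁? P?) bs!)) disjoint
      where
      disjoint : ∀ {x} → ¬ (x ∈ as × x ∈ map (a ∙_) moved)
      disjoint (x∈as , x∈moved) with b , b∈ , refl ← ∈-map⁻ (a ∙_) x∈moved =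
        proj₂ (∈-filter⁻ (∁? P?) {xs = bs} b∈) x∈as

    open LargeSumset (largeSumset₀ n as′ bs′
      (s≤s⁻¹ (ℕ.≤-trans (filter-notAll P? bs some′) bs≤n))
      as′! (Unique.filter⁺ P? bs!)
      (s≤s z≤n)
      (∈-filter⁺ P? ε∈bs (subst (_∈ as) (sym (identityʳ a)) a∈as)))

    split′ : ∀ {c} → (∃₂ λ x y → x ∈ as′ × y ∈ bs′ × c ≡ x ∙ y) →
             ∃₂ λ x y → x ∈ as × y ∈ bs × c ≡ x ∙ y
    split′ (x , y , x∈ , y∈ , refl) with y∈bs , a∙y∈as ← ∈-filter⁻ P? {xs = bs} y∈ | ∈-++⁻ as x∈
    ... | inj₁ x∈as = x , y , x∈as , y∈bs , refl
    ... | inj₂ x∈moved with z , z∈ , refl ← ∈-map⁻ (a ∙_) x∈moved =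
      a ∙ y , z , a∙y∈as , proj₁ (∈-filter⁻ (∁? P?) z∈) ,
      trans (assoc _ _ _) (trans (cong (a ∙_) (comm z y)) (sym (assoc _ _ _)))

    size : length as′ + length bs′ ≡ length as + length bs
    size = begin
      length as′ + length bs′
        ≡⟨ cong (_+ length bs′) (length-++ as) ⟩
      length as + length (map (a ∙_) moved) + length bs′
        ≡⟨ cong (λ l → length as + l + length bs′) (length-map (a ∙_) moved) ⟩
      length as + length moved + length bs′
        ≡⟨ ℕ.+-assoc (length as) _ _ ⟩
      length as + (length moved + length bs′)
        ≡⟨ cong (length as +_) (trans (ℕ.+-comm (length moved) _) (length-filter-∁ P? bs)) ⟩
      length as + length bs ∎
      where open ≡-Reasoning

  full-translate : ∀ {cs} b → Full cs → Full (map (b ∙_) cs)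
  full-translate b full x =
    subst (_∈ _) (\\-leftDividesˡ b x) (∈-map⁺ (b ∙_) (full ((b ⁻¹) ∙ x)))

  -- The Cauchy-Davenport theorem, by translating bs by the inverse of one of
  -- its elements.
  largeSumset : ∀ as bs → Unique as → Unique bs → 0 < length as → 0 < length bs →
                LargeSumset as bs
  largeSumset as bs@(b ∷ bs′) as! bs! 0<as _ = record
    { sums     = map (b ∙_) sums
    ; unique   = Unique.map⁺ (cancelˡ _ _ _) unique
    ; nonempty = subst (0 <_) (sym (length-map (b ∙_) sums)) nonempty
    ; split    = split′
    ; large    = large′ large
    }
    where
    bs₀ = map ((b ⁻¹) ∙_) bs
    open LargeSumset (largeSumset₀ (length bs₀) as bs₀ ℕ.≤-refl as! (Unique.map⁺ (cancelˡ _ _ _) bs!)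
                        0<as (here (sym (inverseˡ b))))

    split′ : ∀ {c} → c ∈ map (b ∙_) sums → ∃₂ λ x y → x ∈ as × y ∈ bs × c ≡ x ∙ y
    split′ c∈ with c′ , c′∈ , refl ← ∈-map⁻ (b ∙_) c∈
      with x , y′ , x∈ , y′∈ , refl ← split c′∈
      with y , y∈ , refl ← ∈-map⁻ ((b ⁻¹) ∙_) {xs = bs} y′∈ =
      x , y , x∈ , y∈ , (begin
        b ∙ (x ∙ ((b ⁻¹) ∙ y)) ≡⟨ assoc _ _ _ ⟨
        (b ∙ x) ∙ ((b ⁻¹) ∙ y) ≡⟨ cong (_∙ ((b ⁻¹) ∙ y)) (comm b x) ⟩
        (x ∙ b) ∙ ((b ⁻¹) ∙ y) ≡⟨ assoc _ _ _ ⟩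
        x ∙ (b ∙ ((b ⁻¹) ∙ y)) ≡⟨ cong (x ∙_) (\\-leftDividesˡ b y) ⟩
        x ∙ y                  ∎)
      where open ≡-Reasoning

    large′ : Full sums ⊎ length as + length bs₀ ≤ suc (length sums) →
             Full (map (b ∙_) sums) ⊎ length as + length bs ≤ suc (length (map (b ∙_) sums))
    large′ (inj₁ full) = inj₁ (full-translate b full)
    large′ (inj₂ le)   = inj₂ (subst₂ (λ k l → length as + k ≤ suc l)
      (length-map ((b ⁻¹) ∙_) bs) (sym (length-map (b ∙_) sums)) le)

  -- The analogue for the sumset of S 0, …, S (k - 1): a nonempty list of
  -- distinct sums, which exhausts the group or has at least
  -- 1 + |S 0| + … + |S (k - 1)| - k elements.
  record LargeIteratedSumset {k} (S : Fin k → List A) : Set where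
    field
      sums     : List A
      unique   : Unique sums
      nonempty : 0 < length sums
      split    : ∀ {c} → c ∈ sums → Σ[ x ∈ (Fin k → A) ] (∀ i → x i ∈ S i) × c ≡ ∑ x
      large    : Full sums ⊎ suc (Vec.foldr _+_ 0 (length ∘ S)) ≤ k + length sums

  largeIteratedSumset : ∀ {k} (S : Fin k → List A) → (∀ i → Unique (S i)) →
                        (∀ i → 0 < length (S i)) → LargeIteratedSumset S
  largeIteratedSumset {zero} S _ _ = record
    { sums = ε ∷ [] ; unique = [] ∷ [] ; nonempty = s≤s z≤n
    ; split = λ { (here refl) → (λ ()) , (λ ()) , refl }
    ; large = inj₂ ℕ.≤-refl }
  largeIteratedSumset {suc k} S S! 0<S
    with largeIteratedSumset (S ∘ suc) (S! ∘ suc) (0<S ∘ suc)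
  ... | record { sums = rest ; unique = rest! ; nonempty = 0<rest ; split = splitʳ ; large = inj₁ full } = record
    { sums = map (b ∙_) rest ; unique = Unique.map⁺ (cancelˡ _ _ _) rest!
    ; nonempty = subst (0 <_) (sym (length-map (b ∙_) rest)) 0<rest
    ; split = λ c∈ → let c′ , c′∈ , c≡ = ∈-map⁻ (b ∙_) c∈ ; x , x∈ , c′≡ = splitʳ c′∈ in
        b Vec.∷ x , (λ { zero → b∈ ; (suc i) → x∈ i }) , trans c≡ (cong (b ∙_) c′≡)
    ; large = inj₁ (full-translate b full) }
    where
    first : Σ[ b ∈ A ] b ∈ S zero
    first with S zero | 0<S zero
    ... | b ∷ _ | _ = b , here refl
    b  = proj₁ first
    b∈ = proj₂ first
  ... | record { sums = rest ; unique = rest! ; nonempty = 0<rest ; split = splitʳ ; large = inj₂ le } = record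
    { sums = sums ; unique = unique ; nonempty = nonempty
    ; split = λ c∈ → let a , b , a∈ , b∈ , c≡ = split c∈ ; x , x∈ , a≡ = splitʳ a∈ in
        b Vec.∷ x , (λ { zero → b∈ ; (suc i) → x∈ i }) ,
        trans c≡ (trans (comm a b) (cong (b ∙_) a≡))
    ; large = Sum.map₂ large′ large }
    where
    open LargeSumset (largeSumset rest (S zero) rest! (S! zero) 0<rest (0<S zero))
    total = Vec.foldr _+_ 0 (length ∘ S ∘ suc)
    large′ : length rest + length (S zero) ≤ suc (length sums) →
             suc (length (S zero) + total) ≤ suc k + length sums
    large′ le′ = begin
      suc (length (S zero) + total)        ≡⟨ ℕ.+-suc _ total ⟨
      length (S zero) + suc total          ≤⟨ ℕ.+-monoʳ-≤ (length (S zero)) le ⟩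
      length (S zero) + (k + length rest)  ≡⟨ ℕ.+-comm (length (S zero)) _ ⟩
      k + length rest + length (S zero)    ≡⟨ ℕ.+-assoc k _ _ ⟩
      k + (length rest + length (S zero))  ≤⟨ ℕ.+-monoʳ-≤ k le′ ⟩
      k + suc (length sums)                ≡⟨ ℕ.+-suc k _ ⟩
      suc k + length sums                  ∎
      where open ℕ.≤-Reasoning

-- The ring of residue classes

module _ {q : ℕ} .{{_ : NonZero q}} where

  toℕ-mod : ∀ a → toℕ (a mod q) ≡ a % q
  toℕ-mod a = toℕ-fromℕ< (m%n<n a q)

  %⇒mod : ∀ {a b} → a % q ≡ b % q → a mod q ≡ b mod q
  %⇒mod {a} {b} eq = toℕ-injective (trans (toℕ-mod a) (trans eq (sym (toℕ-mod b))))

  toℕ-mod-id : ∀ (a : ℤ/ q) → toℕ a mod q ≡ a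
  toℕ-mod-id a = toℕ-injective (trans (toℕ-mod (toℕ a)) (m<n⇒m%n≡m (toℕ<n a)))

  mod-+ : ∀ a b → (a + b) mod q ≡ a mod q +ₘ b mod q
  mod-+ a b = %⇒mod (trans (%-distribˡ-+ a b q)
    (cong₂ (λ x y → (x + y) % q) (sym (toℕ-mod a)) (sym (toℕ-mod b))))

  mod-* : ∀ a b → (a * b) mod q ≡ (a mod q) *ₘ (b mod q)
  mod-* a b = %⇒mod (trans (%-distribˡ-* a b q)
    (cong₂ (λ x y → (x * y) % q) (sym (toℕ-mod a)) (sym (toℕ-mod b))))

  ∣⇒mod≡0 : ∀ {a} → q ∣ a → a mod q ≡ 0ₘ
  ∣⇒mod≡0 {a} q∣a = %⇒mod (trans (n∣m⇒m%n≡0 a q q∣a) (sym (m<n⇒m%n≡m (>-nonZero⁻¹ q))))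

  mod≡0⇒∣ : ∀ {a} → a mod q ≡ 0ₘ → q ∣ a
  mod≡0⇒∣ {a} eq = m%n≡0⇒n∣m a q (trans (sym (toℕ-mod a)) (trans (cong toℕ eq)
    (trans (toℕ-mod 0) (m<n⇒m%n≡m (>-nonZero⁻¹ q)))))

  1ₘ : ℤ/ q
  1ₘ = 1 mod q

  -ₘ_ : ℤ/ q → ℤ/ q
  -ₘ a = (q ∸ toℕ a) mod q

  -- Every law follows from the same law for representatives.
  private
    lift₁ : {P : ℤ/ q → Set} → (∀ a → P (a mod q)) → ∀ a → P a
    lift₁ {P} p a = subst P (toℕ-mod-id a) (p (toℕ a))

    +-assoc : ∀ a b c → (a +ₘ b) +ₘ c ≡ a +ₘ (b +ₘ c)
    +-assoc a b c = begin
      (a +ₘ b) +ₘ c                                ≡⟨ cong ((a +ₘ b) +ₘ_) (toℕ-mod-id c) ⟨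
      (a +ₘ b) +ₘ toℕ c mod q                      ≡⟨ mod-+ (toℕ a + toℕ b) (toℕ c) ⟨
      (toℕ a + toℕ b + toℕ c) mod q                ≡⟨ cong (_mod q) (ℕ.+-assoc (toℕ a) _ _) ⟩
      (toℕ a + (toℕ b + toℕ c)) mod q              ≡⟨ mod-+ (toℕ a) (toℕ b + toℕ c) ⟩
      toℕ a mod q +ₘ (b +ₘ c)                      ≡⟨ cong (_+ₘ (b +ₘ c)) (toℕ-mod-id a) ⟩
      a +ₘ (b +ₘ c)                                ∎
      where open ≡-Reasoning

    *-assoc : ∀ a b c → (a *ₘ b) *ₘ c ≡ a *ₘ (b *ₘ c)
    *-assoc a b c = begin
      (a *ₘ b) *ₘ c                                ≡⟨ cong ((a *ₘ b) *ₘ_) (toℕ-mod-id c) ⟨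
      (a *ₘ b) *ₘ (toℕ c mod q)                    ≡⟨ mod-* (toℕ a * toℕ b) (toℕ c) ⟨
      (toℕ a * toℕ b * toℕ c) mod q                ≡⟨ cong (_mod q) (ℕ.*-assoc (toℕ a) _ _) ⟩
      (toℕ a * (toℕ b * toℕ c)) mod q              ≡⟨ mod-* (toℕ a) (toℕ b * toℕ c) ⟩
      (toℕ a mod q) *ₘ (b *ₘ c)                    ≡⟨ cong (_*ₘ (b *ₘ c)) (toℕ-mod-id a) ⟩
      a *ₘ (b *ₘ c)                                ∎
      where open ≡-Reasoning

    +-comm : ∀ a b → a +ₘ b ≡ b +ₘ a
    +-comm a b = cong (_mod q) (ℕ.+-comm (toℕ a) (toℕ b))

    *-comm : ∀ a b → a *ₘ b ≡ b *ₘ a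
    *-comm a b = cong (_mod q) (ℕ.*-comm (toℕ a) (toℕ b))

    +-identityˡ : ∀ a → 0ₘ +ₘ a ≡ a
    +-identityˡ = lift₁ {λ a → 0ₘ +ₘ a ≡ a} λ a → sym (mod-+ 0 a)

    *-identityˡ : ∀ a → 1ₘ *ₘ a ≡ a
    *-identityˡ = lift₁ {λ a → 1ₘ *ₘ a ≡ a} λ a →
      trans (sym (mod-* 1 a)) (cong (_mod q) (ℕ.*-identityˡ a))

    -‿inverseˡ : ∀ a → (-ₘ a) +ₘ a ≡ 0ₘ
    -‿inverseˡ a = begin
      (-ₘ a) +ₘ a                 ≡⟨ cong ((-ₘ a) +ₘ_) (toℕ-mod-id a) ⟨
      (-ₘ a) +ₘ toℕ a mod q       ≡⟨ mod-+ (q ∸ toℕ a) (toℕ a) ⟨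
      (q ∸ toℕ a + toℕ a) mod q   ≡⟨ cong (_mod q) (ℕ.m∸n+n≡m (ℕ.<⇒≤ (toℕ<n a))) ⟩
      q mod q                     ≡⟨ ∣⇒mod≡0 ∣-refl ⟩
      0ₘ                          ∎
      where open ≡-Reasoning

    distribˡ : ∀ a b c → a *ₘ (b +ₘ c) ≡ a *ₘ b +ₘ a *ₘ c
    distribˡ a b c = begin
      a *ₘ (b +ₘ c)                                ≡⟨ cong (_*ₘ (b +ₘ c)) (toℕ-mod-id a) ⟨
      (toℕ a mod q) *ₘ (b +ₘ c)                    ≡⟨ mod-* (toℕ a) (toℕ b + toℕ c) ⟨
      (toℕ a * (toℕ b + toℕ c)) mod q              ≡⟨ cong (_mod q) (ℕ.*-distribˡ-+ (toℕ a) _ _) ⟩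
      (toℕ a * toℕ b + toℕ a * toℕ c) mod q        ≡⟨ mod-+ (toℕ a * toℕ b) (toℕ a * toℕ c) ⟩
      a *ₘ b +ₘ a *ₘ c                             ∎
      where open ≡-Reasoning

  ℤ/-commutativeRing : CommutativeRing 0ℓ 0ℓ
  ℤ/-commutativeRing = record
    { Carrier = ℤ/ q ; _≈_ = _≡_ ; _+_ = _+ₘ_ ; _*_ = _*ₘ_ ; -_ = -ₘ_ ; 0# = 0ₘ ; 1# = 1ₘ
    ; isCommutativeRing = record
      { isRing = record
        { +-isAbelianGroup = record
          { isGroup = record
            { isMonoid = record
              { isSemigroup = record
                { isMagma = record { isEquivalence = isEquivalence ; ∙-cong = cong₂ _+ₘ_ }
                ; assoc = +-assoc }
              ; identity = comm∧idˡ⇒id +-comm +-identityˡ }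
            ; inverse = comm∧invˡ⇒inv +-comm -‿inverseˡ
            ; ⁻¹-cong = cong -ₘ_ }
          ; comm = +-comm }
        ; *-cong = cong₂ _*ₘ_
        ; *-assoc = *-assoc
        ; *-identity = comm∧idˡ⇒id *-comm *-identityˡ
        ; distrib = distribˡ , comm∧distrˡ⇒distrʳ *-comm distribˡ }
      ; *-comm = *-comm } }
    where open Consequences

-- Reduction modulo a divisor p of q is a ring homomorphism.
module _ {p q : ℕ} .{{_ : NonZero p}} .{{_ : NonZero q}} (p∣q : p ∣ q) where

  toℕ-mod-mod : ∀ a → toℕ (a mod q) mod p ≡ a mod p
  toℕ-mod-mod a = %⇒mod (trans (cong (_% p) (toℕ-mod a)) (m∣n⇒o%n%m≡o%m p q a p∣q))

  reduce-+ : ∀ (a b : ℤ/ q) → toℕ (a +ₘ b) mod p ≡ toℕ a mod p +ₘ toℕ b mod p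
  reduce-+ a b = trans (toℕ-mod-mod (toℕ a + toℕ b)) (mod-+ (toℕ a) (toℕ b))

  reduce-* : ∀ (a b : ℤ/ q) → toℕ (a *ₘ b) mod p ≡ (toℕ a mod p) *ₘ (toℕ b mod p)
  reduce-* a b = trans (toℕ-mod-mod (toℕ a * toℕ b)) (mod-* (toℕ a) (toℕ b))

  reduce-unit : ∀ (a : ℤ/ q) → IsUnit a → IsUnit (toℕ a mod p)
  reduce-unit a unit (d∣a , d∣p) =
    unit (∣n∣m%n⇒∣m d∣p (subst (_ ∣_) (toℕ-mod (toℕ a)) d∣a) , ∣-trans d∣p p∣q)

  reduce-sumₘ : ∀ {k} (x : Fin k → ℤ/ q) → toℕ (sumₘ x) mod p ≡ sumₘ (λ i → toℕ (x i) mod p)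
  reduce-sumₘ {zero}  x = toℕ-mod-mod 0
  reduce-sumₘ {suc k} x = trans (reduce-+ (x zero) _) (cong ((toℕ (x zero) mod p) +ₘ_) (reduce-sumₘ (λ i → x (suc i))))

sumₘ-cong : ∀ {k q} .{{_ : NonZero q}} {x y : Fin k → ℤ/ q} → (∀ i → x i ≡ y i) → sumₘ x ≡ sumₘ y
sumₘ-cong {q = q} = MonoidSums.sum-cong-≗ (CommutativeRing.+-monoid (ℤ/-commutativeRing {q}))

coprime⇒inverse : ∀ {m n} .{{_ : NonZero n}} → Coprime m n → ∃[ w ] (w * m) mod n ≡ 1ₘ
coprime⇒inverse {m} {n} c with coprime-Bézout c
... | Bézout.+- x y eq = x , (begin
  (x * m) mod n       ≡⟨ cong (_mod n) eq ⟨
  (1 + y * n) mod n   ≡⟨ %⇒mod ([m+kn]%n≡m%n 1 y n) ⟩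
  1ₘ                  ∎)
  where open ≡-Reasoning
-- Here 1 + x * m = y * n, so that x * m is -1 modulo n and x * m * x is an
-- inverse of m.
... | Bézout.-+ x y eq = x * m * x , (begin
  (x * m * x * m) mod n
    ≡⟨ %⇒mod ([m+kn]%n≡m%n (x * m * x * m) y n) ⟨
  (x * m * x * m + y * n) mod n
    ≡⟨ cong (λ t → (x * m * x * m + t) mod n) eq ⟨
  (x * m * x * m + (1 + x * m)) mod n
    ≡⟨ cong (_mod n) (solve 2 (λ x m →
         x :* m :* x :* m :+ (con 1 :+ x :* m) := con 1 :+ x :* m :* (con 1 :+ x :* m)) refl x m) ⟩
  (1 + x * m * (1 + x * m)) mod n
    ≡⟨ cong (λ t → (1 + x * m * t) mod n) eq ⟩
  (1 + x * m * (y * n)) mod n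
    ≡⟨ cong (λ t → (1 + t) mod n) (ℕ.*-assoc (x * m) y n) ⟨
  (1 + x * m * y * n) mod n
    ≡⟨ %⇒mod ([m+kn]%n≡m%n 1 (x * m * y) n) ⟩
  1ₘ ∎)
  where
  open ≡-Reasoning
  open +-*-Solver

module _ {p : ℕ} .{{_ : NonZero p}} (pr : Prime p) where

  ℤ/p-noZeroDivisors : ∀ (x y : ℤ/ p) → x *ₘ y ≡ 0ₘ → x ≡ 0ₘ ⊎ y ≡ 0ₘ
  ℤ/p-noZeroDivisors x y eq with euclidsLemma (toℕ x) (toℕ y) pr (mod≡0⇒∣ eq)
  ... | inj₁ p∣x = inj₁ (trans (sym (toℕ-mod-id x)) (∣⇒mod≡0 p∣x))
  ... | inj₂ p∣y = inj₂ (trans (sym (toℕ-mod-id y)) (∣⇒mod≡0 p∣y))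

  nonzero⇒unit : ∀ {x : ℤ/ p} → x ≢ 0ₘ → IsUnit x
  nonzero⇒unit {x} x≢0 = go (toℕ x) refl
    where
    go : ∀ n → n ≡ toℕ x → Coprime (toℕ x) p
    go zero    eq = contradiction (trans (sym (toℕ-mod-id x)) (cong (_mod p) (sym eq))) x≢0
    go (suc n) eq = subst (λ m → Coprime m p) eq
      (Coprimality.sym (prime⇒coprime pr (subst (_< p) (sym eq) (toℕ<n x))))

  -- Every nonzero class generates the additive group: x is a multiple of b
  -- because b is invertible.
  ℤ/p-generates : ∀ (b : ℤ/ p) → b ≢ 0ₘ → (P : ℤ/ p → Set) →
                  P 0ₘ → (∀ {x} → P x → P (x +ₘ b)) → ∀ x → P x
  ℤ/p-generates b b≢0 P P0 P+b x with w , eq ← coprime⇒inverse (nonzero⇒unit b≢0) =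
    subst P (begin
      (toℕ x * w * toℕ b) mod p             ≡⟨ cong (_mod p) (ℕ.*-assoc (toℕ x) w _) ⟩
      (toℕ x * (w * toℕ b)) mod p           ≡⟨ mod-* (toℕ x) (w * toℕ b) ⟩
      (toℕ x mod p) *ₘ ((w * toℕ b) mod p)  ≡⟨ cong₂ _*ₘ_ (toℕ-mod-id x) eq ⟩
      x *ₘ 1ₘ                               ≡⟨ CommutativeRing.*-identityʳ (ℤ/-commutativeRing {p}) x ⟩
      x                                     ∎)
      (multiple (toℕ x * w))
    where
    open ≡-Reasoning
    multiple : ∀ k → P ((k * toℕ b) mod p)
    multiple zero    = P0
    multiple (suc k) = subst P (begin
      (k * toℕ b) mod p +ₘ b              ≡⟨ cong ((k * toℕ b) mod p +ₘ_) (toℕ-mod-id b) ⟨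
      (k * toℕ b) mod p +ₘ toℕ b mod p    ≡⟨ mod-+ (k * toℕ b) (toℕ b) ⟨
      (k * toℕ b + toℕ b) mod p           ≡⟨ cong (_mod p) (ℕ.+-comm (k * toℕ b) (toℕ b)) ⟩
      (toℕ b + k * toℕ b) mod p           ∎)
      (P+b (multiple k))

-- The number of cubic residues modulo a prime

-- An element of an integral domain has at most three cube roots. The identities
-- behind this have natural coefficients, when the roots other than x are
-- described by their differences from x.
module CubeRoots {c ℓ} (R : CommutativeRing c ℓ) where

  open CommutativeRing R
    renaming (_+_ to _⊕_; _*_ to _⊗_; refl to ≈-refl; sym to ≈-sym; trans to ≈-trans)
  open GroupProperties +-group using (∙-cancelˡ; ∙-cancelʳ; x∙y⁻¹≈ε⇒x≈y)
  open NaturalSolver commutativeSemiring using (solve; _:=_; _:+_; _:*_)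
  open import Relation.Binary.Reasoning.Setoid setoid

  private
    -- The polynomial 3x² + 3xt + t², for which (x + t)³ = x³ + t Q(x, t).
    Q : Carrier → Carrier → Carrier
    Q x t = (x ⊕ x ⊕ x) ⊗ x ⊕ (x ⊕ x ⊕ x) ⊗ t ⊕ t ⊗ t

    x+[y-x]≈y : ∀ x y → x ⊕ (y - x) ≈ y
    x+[y-x]≈y x y = begin
      x ⊕ (y - x)     ≈⟨ +-congˡ (+-comm y (- x)) ⟩
      x ⊕ (- x ⊕ y)   ≈⟨ +-assoc x (- x) y ⟨
      (x - x) ⊕ y     ≈⟨ +-congʳ (-‿inverseʳ x) ⟩
      0# ⊕ y          ≈⟨ +-identityˡ y ⟩
      y               ∎

  module _ (noZeroDivisors : ∀ x y → x ⊗ y ≈ 0# → x ≈ 0# ⊎ y ≈ 0#) where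

    private
      Q≈0 : ∀ x y → x ⊗ x ⊗ x ≈ y ⊗ y ⊗ y → ¬ x ≈ y → Q x (y - x) ≈ 0#
      Q≈0 x y eq x≉y with noZeroDivisors (y - x) (Q x (y - x)) (∙-cancelˡ (x ⊗ x ⊗ x) _ _ (begin
        x ⊗ x ⊗ x ⊕ (y - x) ⊗ Q x (y - x)
          ≈⟨ solve 2 (λ x t → x :* x :* x :+ t :* ((x :+ x :+ x) :* x :+ (x :+ x :+ x) :* t :+ t :* t)
                            := (x :+ t) :* (x :+ t) :* (x :+ t)) ≈-refl x (y - x) ⟩
        (x ⊕ (y - x)) ⊗ (x ⊕ (y - x)) ⊗ (x ⊕ (y - x))
          ≈⟨ *-cong (*-cong (x+[y-x]≈y x y) (x+[y-x]≈y x y)) (x+[y-x]≈y x y) ⟩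
        y ⊗ y ⊗ y      ≈⟨ eq ⟨
        x ⊗ x ⊗ x      ≈⟨ +-identityʳ _ ⟨
        x ⊗ x ⊗ x ⊕ 0# ∎))
      ... | inj₁ y-x≈0 = contradiction (≈-sym (x∙y⁻¹≈ε⇒x≈y y x y-x≈0)) x≉y
      ... | inj₂ eq′   = eq′

      -- Two distinct roots d and e of Q(x, _) have sum -3x, since
      -- Q(x, e) - Q(x, d) = (e - d) (3x + d + e).
      rootSum : ∀ x d e → Q x d ≈ 0# → Q x e ≈ 0# → ¬ d ≈ e → x ⊕ x ⊕ x ⊕ d ⊕ e ≈ 0#
      rootSum x d e Qd Qe d≉e with noZeroDivisors (e - d) (x ⊕ x ⊕ x ⊕ d ⊕ (d ⊕ (e - d))) (begin
        (e - d) ⊗ (x ⊕ x ⊕ x ⊕ d ⊕ (d ⊕ (e - d)))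
          ≈⟨ +-identityˡ _ ⟨
        0# ⊕ (e - d) ⊗ (x ⊕ x ⊕ x ⊕ d ⊕ (d ⊕ (e - d)))
          ≈⟨ +-congʳ Qd ⟨
        Q x d ⊕ (e - d) ⊗ (x ⊕ x ⊕ x ⊕ d ⊕ (d ⊕ (e - d)))
          ≈⟨ solve 3 (λ x d g →
               (x :+ x :+ x) :* x :+ (x :+ x :+ x) :* d :+ d :* d :+ g :* (x :+ x :+ x :+ d :+ (d :+ g))
               := (x :+ x :+ x) :* x :+ (x :+ x :+ x) :* (d :+ g) :+ (d :+ g) :* (d :+ g))
               ≈-refl x d (e - d) ⟩
        Q x (d ⊕ (e - d))
          ≈⟨ +-cong (+-congˡ (*-congˡ d+[e-d])) (*-cong d+[e-d] d+[e-d]) ⟩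
        Q x e  ≈⟨ Qe ⟩
        0#     ∎)
        where d+[e-d] = x+[y-x]≈y d e
      ... | inj₁ e-d≈0 = contradiction (≈-sym (x∙y⁻¹≈ε⇒x≈y e d e-d≈0)) d≉e
      ... | inj₂ sum≈0 = ≈-trans (+-congˡ (≈-sym (x+[y-x]≈y d e))) sum≈0

    -- If the other roots are x + d, x + e and x + f, then d + e = -3x = d + f.
    noFourCubeRoots : ∀ {a x y z w} →
      x ⊗ x ⊗ x ≈ a → y ⊗ y ⊗ y ≈ a → z ⊗ z ⊗ z ≈ a → w ⊗ w ⊗ w ≈ a →
      ¬ x ≈ y → ¬ x ≈ z → ¬ x ≈ w → ¬ y ≈ z → ¬ y ≈ w → z ≈ w
    noFourCubeRoots {a} {x} {y} {z} {w} x³ y³ z³ w³ x≉y x≉z x≉w y≉z y≉w =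
      ∙-cancelʳ (- x) z w (∙-cancelˡ (x ⊕ x ⊕ x ⊕ (y - x)) _ _ (≈-trans
        (rootSum x _ _ (root y³ x≉y) (root z³ x≉z) (y≉z ∘ ∙-cancelʳ (- x) y z))
        (≈-sym (rootSum x _ _ (root y³ x≉y) (root w³ x≉w) (y≉w ∘ ∙-cancelʳ (- x) y w)))))
      where
      root : ∀ {v} → v ⊗ v ⊗ v ≈ a → ¬ x ≈ v → Q x (v - x) ≈ 0#
      root {v} v³ = Q≈0 x v (≈-trans x³ (≈-sym v³))

module _ (q : ℕ) .{{_ : NonZero q}} where

  -- The cubic residues as residue classes, without membership proofs.
  cubicResidueClasses : List (ℤ/ q)
  cubicResidueClasses = map value (cubicResidues q)

  cubicResidueClasses-unique : Unique cubicResidueClasses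
  cubicResidueClasses-unique =
    subst Unique (sym (go (allFin q))) (Unique.filter⁺ isCubicResidue? (Unique.allFin⁺ q))
    where
    go : ∀ as → map value (mapMaybe (toCubicResidue q) as) ≡ filter isCubicResidue? as
    go []       = refl
    go (a ∷ as) with isCubicResidue? a
    ... | yes _ = cong (a ∷_) (go as)
    ... | no  _ = go as

  cubicResidues-unique : Unique (cubicResidues q)
  cubicResidues-unique = Unique.map⁻ cubicResidueClasses-unique

cube∈cubicResidueClasses : ∀ {q} .{{_ : NonZero q}} {x : ℤ/ q} → IsUnit x →
                           x *ₘ x *ₘ x ∈ cubicResidueClasses q
cube∈cubicResidueClasses {q} {x} unit =
  ∈-map⁺ value (∈-cubicResidues q (x *ₘ x *ₘ x , [ x , unit , refl ]))

module _ {m : ℕ} (pr : Prime (suc m)) where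

  private
    p = suc m
    open CubeRoots (ℤ/-commutativeRing {p}) using (noFourCubeRoots)

  length-cubeRoots≤3 : ∀ (a : ℤ/ p) xs → Unique xs → (∀ {x} → x ∈ xs → x *ₘ x *ₘ x ≡ a) →
                       length xs ≤ 3
  length-cubeRoots≤3 a []              _ _ = z≤n
  length-cubeRoots≤3 a (_ ∷ [])        _ _ = s≤s z≤n
  length-cubeRoots≤3 a (_ ∷ _ ∷ [])    _ _ = s≤s (s≤s z≤n)
  length-cubeRoots≤3 a (_ ∷ _ ∷ _ ∷ []) _ _ = s≤s (s≤s (s≤s z≤n))
  length-cubeRoots≤3 a (_ ∷ _ ∷ _ ∷ _ ∷ _)
    ((x≢y ∷ x≢z ∷ x≢w ∷ _) ∷ (y≢z ∷ y≢w ∷ _) ∷ (z≢w ∷ _) ∷ _) cube =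
    contradiction
      (noFourCubeRoots (ℤ/p-noZeroDivisors pr) (cube (here refl)) (cube (there (here refl)))
        (cube (there (there (here refl)))) (cube (there (there (there (here refl)))))
        x≢y x≢z x≢w y≢z y≢w)
      z≢w

  -- Cubing maps the m = p - 1 nonzero classes to cubic residues, and at most
  -- three classes to the same one.
  p-1≤φ₃*3 : m ≤ φ₃ p * 3
  p-1≤φ₃*3 = subst₂ (λ k l → k ≤ l * 3) (length-tabulate {n = m} suc) (length-map value (cubicResidues p))
    (length-fibres Fin._≟_ (λ x → x *ₘ x *ₘ x) 3 length-cubeRoots≤3
      (cubicResidueClasses p) (tabulate {n = m} suc) (Unique.tabulate⁺ suc-injective) cube∈)
    where
    suc≢0 : ∀ (i : Fin m) → suc i ≢ 0ₘ {p}
    suc≢0 i eq with () ← trans (cong toℕ eq) (toℕ-mod {p} 0)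
    cube∈ : ∀ {x} → x ∈ tabulate {n = m} suc → x *ₘ x *ₘ x ∈ cubicResidueClasses p
    cube∈ x∈ with i , refl ← ∈-tabulate⁻ x∈ =
      cube∈cubicResidueClasses {p} (nonzero⇒unit pr (suc≢0 i))

private
  quotient< : ∀ h c {m} → c * 3 < m → m ≤ h * 3 → c < h
  quotient< h c c*3<m m≤h*3 = ℕ.*-cancelʳ-< 3 _ _ (ℕ.≤-trans c*3<m m≤h*3)

  1+m+3≤4h : ∀ h {m} → 9 < m → m ≤ h * 3 → suc m + 3 ≤ 4 * h
  1+m+3≤4h h {m} 9<m m≤h*3 = begin
    suc m + 3   ≡⟨ ℕ.+-comm (suc m) 3 ⟩
    4 + m       ≤⟨ ℕ.+-mono-≤ (quotient< h 3 9<m m≤h*3) m≤h*3 ⟩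
    h + h * 3   ≡⟨ cong (h +_) (ℕ.*-comm h 3) ⟩
    4 * h       ∎
    where open ℕ.≤-Reasoning

  primes∤14 : ∀ p → Prime p → Coprime p 14 → p ≡ 3 ⊎ p ≡ 5 ⊎ 10 < p
  primes∤14 0 pr _ = contradiction pr ¬prime[0]
  primes∤14 1 pr _ = contradiction pr ¬prime[1]
  primes∤14 2 _  c with () ← c (divides 1 refl , divides 7 refl)
  primes∤14 3 _  _ = inj₁ refl
  primes∤14 4 pr _ = contradiction composite[4] (prime⇒¬composite pr)
  primes∤14 5 _  _ = inj₂ (inj₁ refl)
  primes∤14 6 pr _ = contradiction composite[6] (prime⇒¬composite pr)
  primes∤14 7 _  c with () ← c (divides 1 refl , divides 2 refl)
  primes∤14 8 pr _ = contradiction (composite-∣ composite[4] (divides 2 refl)) (prime⇒¬composite pr)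
  primes∤14 9 pr _ = contradiction (composite-≢ 3 (λ ()) (divides 3 refl)) (prime⇒¬composite pr)
  primes∤14 10 pr _ = contradiction (composite-≢ 2 (λ ()) (divides 5 refl)) (prime⇒¬composite pr)
  primes∤14 (suc (suc (suc (suc (suc (suc (suc (suc (suc (suc (suc p))))))))))) _ _ =
    inj₂ (inj₂ (ℕ.m≤m+n 11 p))

-- If p > 10, then p - 1 ≤ 3 φ₃ p implies φ₃ p ≥ 4, and adding the two gives the
-- claim. For p = 5 it implies φ₃ p ≥ 2, which suffices, and φ₃ 3 = 2. The claim
-- fails for the primes 2 and 7.
p+3≤4φ₃ : ∀ p .{{_ : NonZero p}} → Prime p → Coprime p 14 → p + 3 ≤ 4 * φ₃ p
p+3≤4φ₃ p@(suc m) pr c with primes∤14 p pr c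
... | inj₁ refl          = ℕ.m≤m+n 6 2
... | inj₂ (inj₁ refl)   = ℕ.*-monoʳ-≤ 4 {2} (quotient< (φ₃ 5) 1 (ℕ.m≤m+n 4 0) (p-1≤φ₃*3 pr))
... | inj₂ (inj₂ 10<p)   = 1+m+3≤4h (φ₃ p) (s≤s⁻¹ 10<p) (p-1≤φ₃*3 pr)

-- Cubic residues and the Chinese remainder theorem

%-≡⇒∣∸ : ∀ {a b n} .{{_ : NonZero n}} → a % n ≡ b % n → n ∣ a ∸ b
%-≡⇒∣∸ {a} {b} {n} eq = divides (a div n ∸ b div n) (begin
  a ∸ b                                          ≡⟨ cong₂ _∸_ (m≡m%n+[m/n]*n a n) (m≡m%n+[m/n]*n b n) ⟩
  (a % n + a div n * n) ∸ (b % n + b div n * n)      ≡⟨ cong (λ r → (a % n + a div n * n) ∸ (r + b div n * n)) eq ⟨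
  (a % n + a div n * n) ∸ (a % n + b div n * n)      ≡⟨ ℕ.[m+n]∸[m+o]≡n∸o (a % n) _ _ ⟩
  a div n * n ∸ b div n * n                          ≡⟨ ℕ.*-distribʳ-∸ n (a div n) (b div n) ⟨
  (a div n ∸ b div n) * n                            ∎)
  where open ≡-Reasoning

coprime⇒*-∣ : ∀ {m n d} → Coprime m n → m ∣ d → n ∣ d → m * n ∣ d
coprime⇒*-∣ {m} {n} c m∣d (divides k refl) =
  *-monoˡ-∣ n (coprime-divisor c (subst (m ∣_) (ℕ.*-comm k n) m∣d))

module ChineseRemainder {p q : ℕ} .{{_ : NonZero p}} .{{_ : NonZero q}} (coprime : Coprime p q) where

  instance
    p*q-nonZero : NonZero (p * q)
    p*q-nonZero = ℕ.m*n≢0 p q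

  private
    p∣pq : p ∣ p * q
    p∣pq = m∣m*n q
    q∣pq : q ∣ p * q
    q∣pq = n∣m*n p

  crt-injective : ∀ {c d : ℤ/ (p * q)} → toℕ c mod p ≡ toℕ d mod p → toℕ c mod q ≡ toℕ d mod q → c ≡ d
  crt-injective {c} {d} eqp eqq = toℕ-injective (ℕ.≤-antisym (c≤d eqp eqq) (c≤d (sym eqp) (sym eqq)))
    where
    %-≡ : ∀ {n} .{{_ : NonZero n}} {a b} → a mod n ≡ b mod n → a % n ≡ b % n
    %-≡ {a = a} {b} eq = trans (sym (toℕ-mod a)) (trans (cong toℕ eq) (toℕ-mod b))

    c≤d : ∀ {c d : ℤ/ (p * q)} → toℕ c mod p ≡ toℕ d mod p → toℕ c mod q ≡ toℕ d mod q → toℕ c ≤ toℕ d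
    c≤d {c} {d} eqp eqq with toℕ c ∸ toℕ d in eq
      | coprime⇒*-∣ coprime (%-≡⇒∣∸ {toℕ c} {toℕ d} (%-≡ eqp)) (%-≡⇒∣∸ {toℕ c} {toℕ d} (%-≡ eqq))
    ... | zero  | _    = ℕ.m∸n≡0⇒m≤n eq
    ... | suc t | pq∣t = contradiction (subst (_< p * q) eq (ℕ.≤-<-trans (ℕ.m∸n≤m (toℕ c) (toℕ d)) (toℕ<n c))) (ℕ.≤⇒≯ (∣⇒≤ pq∣t))

  private
    -- The inverses of q modulo p and of p modulo q.
    q⁻¹ = proj₁ (coprime⇒inverse {q} {p} (Coprimality.sym coprime))
    p⁻¹ = proj₁ (coprime⇒inverse {p} {q} coprime)

    interpolate : ∀ {n} .{{_ : NonZero n}} (a : ℤ/ n) {u v} → u mod n ≡ 1ₘ → n ∣ v → ∀ b →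
                  (toℕ a * u + b * v) mod n ≡ a
    interpolate {n} a {u} {v} u≡1 n∣v b = begin
      (toℕ a * u + b * v) mod n                ≡⟨ mod-+ (toℕ a * u) (b * v) ⟩
      (toℕ a * u) mod n +ₘ (b * v) mod n       ≡⟨ cong₂ _+ₘ_ (mod-* (toℕ a) u) (∣⇒mod≡0 (∣n⇒∣m*n b n∣v)) ⟩
      (toℕ a mod n) *ₘ (u mod n) +ₘ 0ₘ         ≡⟨ +-identityʳ _ ⟩
      (toℕ a mod n) *ₘ (u mod n)               ≡⟨ cong₂ _*ₘ_ (toℕ-mod-id a) u≡1 ⟩
      a *ₘ 1ₘ                                  ≡⟨ *-identityʳ a ⟩
      a                                        ∎
      where
      open ≡-Reasoning
      open CommutativeRing (ℤ/-commutativeRing {n}) using (+-identityʳ; *-identityʳ)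

  -- The class modulo p q which is a modulo p and b modulo q.
  crt : ℤ/ p → ℤ/ q → ℤ/ (p * q)
  crt a b = (toℕ a * (q⁻¹ * q) + toℕ b * (p⁻¹ * p)) mod (p * q)

  crt-mod-p : ∀ a b → toℕ (crt a b) mod p ≡ a
  crt-mod-p a b = trans (toℕ-mod-mod p∣pq (toℕ a * (q⁻¹ * q) + toℕ b * (p⁻¹ * p)))
    (interpolate a {q⁻¹ * q} {p⁻¹ * p} (proj₂ (coprime⇒inverse (Coprimality.sym coprime))) (n∣m*n p⁻¹) (toℕ b))

  crt-mod-q : ∀ a b → toℕ (crt a b) mod q ≡ b
  crt-mod-q a b = trans (toℕ-mod-mod q∣pq (toℕ a * (q⁻¹ * q) + toℕ b * (p⁻¹ * p)))
    (trans (cong (_mod q) (ℕ.+-comm (toℕ a * (q⁻¹ * q)) _))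
      (interpolate b {p⁻¹ * p} {q⁻¹ * q} (proj₂ (coprime⇒inverse coprime)) (n∣m*n q⁻¹) (toℕ a)))

  -- A common divisor d of crt x y and p q is coprime to p, as x is a unit
  -- modulo p, and hence divides q. As y is a unit modulo q, d is 1.
  crt-unit : ∀ {x : ℤ/ p} {y : ℤ/ q} → IsUnit x → IsUnit y → IsUnit (crt x y)
  crt-unit {x} {y} ux uy {d} (d∣z , d∣pq) = uy (d∣y , d∣q)
    where
    ∣mod : ∀ n .{{_ : NonZero n}} {e} → e ∣ toℕ (crt x y) → e ∣ n → e ∣ toℕ (toℕ (crt x y) mod n)
    ∣mod n e∣z e∣n = subst (_ ∣_) (sym (toℕ-mod (toℕ (crt x y)))) (%-presˡ-∣ e∣z e∣n)
    d∣q : d ∣ q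
    d∣q = coprime-divisor {d} {p} {q}
      (λ (e∣d , e∣p) → ux (subst (λ t → _ ∣ toℕ t) (crt-mod-p x y) (∣mod p (∣-trans e∣d d∣z) e∣p) , e∣p))
      d∣pq
    d∣y : d ∣ toℕ y
    d∣y = subst (λ t → _ ∣ toℕ t) (crt-mod-q x y) (∣mod q d∣z d∣q)

  crt-sumₘ : ∀ {k} (n : ℤ/ (p * q)) (x : Fin k → ℤ/ p) (y : Fin k → ℤ/ q) →
             toℕ n mod p ≡ sumₘ x → toℕ n mod q ≡ sumₘ y → n ≡ sumₘ (λ i → crt (x i) (y i))
  crt-sumₘ n x y eqp eqq = crt-injective
    (trans eqp (sym (trans (reduce-sumₘ p∣pq (λ i → crt (x i) (y i)))
      (sumₘ-cong (λ i → crt-mod-p (x i) (y i))))))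
    (trans eqq (sym (trans (reduce-sumₘ q∣pq (λ i → crt (x i) (y i)))
      (sumₘ-cong (λ i → crt-mod-q (x i) (y i))))))

  reduce-cube : ∀ {d} .{{_ : NonZero d}} (d∣ : d ∣ p * q) (x : ℤ/ (p * q)) →
    toℕ (x *ₘ x *ₘ x) mod d ≡ (toℕ x mod d) *ₘ (toℕ x mod d) *ₘ (toℕ x mod d)
  reduce-cube d∣ x = trans (reduce-* d∣ (x *ₘ x) x) (cong (_*ₘ (toℕ x mod _)) (reduce-* d∣ x x))

  -- Reduction of cubic residues modulo p q to cubic residues modulo d.
  reduceResidue : ∀ {d} .{{_ : NonZero d}} → d ∣ p * q → ℤ/ (p * q) ⁽³⁾ → ℤ/ d ⁽³⁾
  reduceResidue {d} d∣ = Refinement.map (λ a → toℕ a mod d)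
    λ (x , unit , x³≡a) → toℕ x mod d , reduce-unit d∣ x unit ,
      trans (sym (reduce-cube d∣ x)) (cong (λ a → toℕ a mod d) x³≡a)

  crt-isCubicResidue : ∀ {a : ℤ/ p} {b : ℤ/ q} → IsCubicResidue a → IsCubicResidue b → IsCubicResidue (crt a b)
  crt-isCubicResidue {a} {b} (x , ux , x³≡a) (y , uy , y³≡b) = z , crt-unit ux uy , crt-injective
    (trans (reduce-cube p∣pq z) (trans (cong (λ t → t *ₘ t *ₘ t) (crt-mod-p x y)) (trans x³≡a (sym (crt-mod-p a b)))))
    (trans (reduce-cube q∣pq z) (trans (cong (λ t → t *ₘ t *ₘ t) (crt-mod-q x y)) (trans y³≡b (sym (crt-mod-q a b)))))
    where z = crt x y

  -- The cubic residue modulo p q with given residues modulo p and q.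
  crtResidue : ℤ/ p ⁽³⁾ → ℤ/ q ⁽³⁾ → ℤ/ (p * q) ⁽³⁾
  crtResidue (a , [ a³ ]) (b , [ b³ ]) = crt a b , [ crt-isCubicResidue a³ b³ ]

  cubicResidues-* : cubicResidues (p * q) ↭ cartesianProductWith crtResidue (cubicResidues p) (cubicResidues q)
  cubicResidues-* = ∼bag⇒↭ (unique∧set⇒bag (cubicResidues-unique (p * q))
    (Unique.cartesianProductWith⁺ crtResidue injective (cubicResidues-unique p) (cubicResidues-unique q))
    (λ {c} → mk⇔ (λ _ → to c) (λ _ → ∈-cubicResidues (p * q) c)))
    where
    injective : ∀ {w x y z} → crtResidue w y ≡ crtResidue x z → w ≡ x × y ≡ z
    injective {w} {x} {y} {z} eq =
      value-injective (trans (sym (crt-mod-p (value w) (value y))) (trans (cong (λ c → toℕ (value c) mod p) eq) (crt-mod-p (value x) (value z)))) ,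
      value-injective (trans (sym (crt-mod-q (value w) (value y))) (trans (cong (λ c → toℕ (value c) mod q) eq) (crt-mod-q (value x) (value z))))

    to : ∀ c → c ∈ cartesianProductWith crtResidue (cubicResidues p) (cubicResidues q)
    to c = subst (_∈ _) (value-injective (crt-injective
        (crt-mod-p (toℕ (value c) mod p) (toℕ (value c) mod q))
        (crt-mod-q (toℕ (value c) mod p) (toℕ (value c) mod q))))
      (∈-cartesianProductWith⁺ crtResidue (∈-cubicResidues p (reduceResidue p∣pq c)) (∈-cubicResidues q (reduceResidue q∣pq c)))

-- Averaging in an ordered commutative monoid

-- The values V form a commutative monoid with a decidable total order which is
-- compatible with ∙.
module Averaging
  (M : CommutativeMonoid 0ℓ 0ℓ)
  {_≼_ : CommutativeMonoid.Carrier M → CommutativeMonoid.Carrier M → Set}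
  (isDecTotalOrder : IsDecTotalOrder (CommutativeMonoid._≈_ M) _≼_)
  (∙-mono : ∀ x y z w → x ≼ y → z ≼ w → CommutativeMonoid._∙_ M x z ≼ CommutativeMonoid._∙_ M y w)
  where

  open CommutativeMonoid M
    using (_≈_; _∙_; setoid; assoc; comm; identityˡ; ∙-cong; ∙-congˡ; ∙-congʳ)
    renaming (Carrier to V; refl to ≈-refl; sym to ≈-sym; trans to ≈-trans)
  open IsDecTotalOrder isDecTotalOrder using (total)
    renaming (refl to ≼-refl; trans to ≼-trans; ≲-respʳ-≈ to ≼-respʳ-≈; ≲-respˡ-≈ to ≼-respˡ-≈)
  open FiniteSums M using (sum; sum-cong-≋; ∑-comm; sum-permute)
  open import Relation.Binary.Reasoning.Setoid setoid

  sum-mono : ∀ {k} {f g : Fin k → V} → (∀ i → f i ≼ g i) → sum f ≼ sum g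
  sum-mono {zero}  f≤g = ≼-refl
  sum-mono {suc k} f≤g = ∙-mono _ _ _ _ (f≤g zero) (sum-mono (f≤g ∘ suc))

  maximum : ∀ {k} (v : Fin (suc k) → V) → ∃[ j ] (∀ i → v i ≼ v j)
  maximum {zero}  v = zero , λ { zero → ≼-refl }
  maximum {suc k} v with j , v≤vj ← maximum (v ∘ suc) | total (v zero) (v (suc j))
  ... | inj₁ v₀≤vj = suc j , λ { zero → v₀≤vj ; (suc i) → v≤vj i }
  ... | inj₂ vj≤v₀ = zero , λ { zero → ≼-refl ; (suc i) → ≼-trans (v≤vj i) vj≤v₀ }

  -- The sum of g over the entries of a list.
  ∑ : ∀ {A : Set} → List A → (A → V) → V
  ∑ xs g = sum (λ j → g (Vec.fromList xs j))

  ∑-cong : ∀ {A : Set} (xs : List A) {g h : A → V} → (∀ a → g a ≈ h a) → ∑ xs g ≈ ∑ xs h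
  ∑-cong xs g≈h = sum-cong-≋ (λ j → g≈h (lookup xs j))

  ∑-↭ : ∀ {A : Set} {xs ys : List A} (g : A → V) → xs ↭ ys → ∑ xs g ≈ ∑ ys g
  ∑-↭ g ↭.refl         = ≈-refl
  ∑-↭ g (↭.prep x p)   = ∙-congˡ (∑-↭ g p)
  ∑-↭ g (↭.swap {xs} {ys} x y p) = begin
    g x ∙ (g y ∙ ∑ xs g)  ≈⟨ ∙-congˡ (∙-congˡ (∑-↭ g p)) ⟩
    g x ∙ (g y ∙ ∑ ys g)  ≈⟨ assoc _ _ _ ⟨
    g x ∙ g y ∙ ∑ ys g    ≈⟨ ∙-congʳ (comm _ _) ⟩
    g y ∙ g x ∙ ∑ ys g    ≈⟨ assoc _ _ _ ⟩
    g y ∙ (g x ∙ ∑ ys g)  ∎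
  ∑-↭ g (↭.trans p p′) = ≈-trans (∑-↭ g p) (∑-↭ g p′)

  ∑-++ : ∀ {A : Set} (xs : List A) {ys} (g : A → V) → ∑ (xs ++ ys) g ≈ ∑ xs g ∙ ∑ ys g
  ∑-++ []       g = ≈-sym (identityˡ _)
  ∑-++ (x ∷ xs) g = ≈-trans (∙-congˡ (∑-++ xs g)) (≈-sym (assoc _ _ _))

  ∑-map : ∀ {A B : Set} (h : A → B) xs (g : B → V) → ∑ (map h xs) g ≈ ∑ xs (g ∘ h)
  ∑-map h []       g = ≈-refl
  ∑-map h (x ∷ xs) g = ∙-congˡ (∑-map h xs g)

  ∑-cartesianProductWith : ∀ {A B C : Set} (h : A → B → C) xs ys (g : C → V) →
    ∑ (cartesianProductWith h xs ys) g ≈ ∑ xs (λ a → ∑ ys (λ b → g (h a b)))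
  ∑-cartesianProductWith h []       ys g = ≈-refl
  ∑-cartesianProductWith h (x ∷ xs) ys g = ≈-trans (∑-++ (map (h x) ys) g)
    (∙-cong (∑-map (h x) ys g) (∑-cartesianProductWith h xs ys g))

  -- For all functions f 0, …, f (k - 1), some tuple x in Sol has a sum of the
  -- f i (x i) at least as large as the average over a in xs of the sum of the
  -- f i a. Both sides are multiplied by the length of xs.
  Averaging : ∀ {k} {A : Set} → List A → ((Fin k → A) → Set) → Set
  Averaging {k} {A} xs Sol = (f : Fin k → A → V) →
    Σ[ x ∈ (Fin k → A) ] Sol x ×
      ∑ xs (λ a → sum (λ i → f i a)) ≼ ∑ xs (λ _ → sum (λ i → f i (x i)))

  ∑-sum-comm : ∀ {k} {A : Set} (xs : List A) (f : Fin k → A → V) →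
               ∑ xs (λ a → sum (λ i → f i a)) ≈ sum (λ i → ∑ xs (f i))
  ∑-sum-comm xs f = ∑-comm (λ j i → f i (lookup xs j))

  Averaging-cartesianProduct : ∀ {k} {A B C : Set} {xs : List A} {ys : List B} {zs : List C}
    {SolA : (Fin k → A) → Set} {SolB : (Fin k → B) → Set} {SolC : (Fin k → C) → Set}
    (h : A → B → C) → zs ↭ cartesianProductWith h xs ys →
    (∀ {x y} → SolA x → SolB y → SolC (λ i → h (x i) (y i))) →
    Averaging xs SolA → Averaging ys SolB → Averaging zs SolC
  Averaging-cartesianProduct {xs = xs} {ys} {zs} h zs↭ sol avgA avgB f
    -- Sum over B first, and then fix the A-components which this yields.
    with x , solx , lex ← avgA (λ i a → ∑ ys (λ b → f i (h a b)))
    with y , soly , ley ← avgB (λ i b → f i (h (x i) b)) =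
    (λ i → h (x i) (y i)) , sol solx soly ,
    ≼-respˡ-≈ (≈-sym before) (≼-trans lex (≼-respʳ-≈ (≈-sym after)
      (sum-mono {length xs} λ _ → ≼-respˡ-≈ (∑-sum-comm ys (λ i b → f i (h (x i) b))) ley)))
    where
    over-zs : ∀ g → ∑ zs g ≈ ∑ xs (λ a → ∑ ys (λ b → g (h a b)))
    over-zs g = ≈-trans (∑-↭ g zs↭) (∑-cartesianProductWith h xs ys g)

    before : ∑ zs (λ c → sum (λ i → f i c)) ≈ ∑ xs (λ a → sum (λ i → ∑ ys (λ b → f i (h a b))))
    before = ≈-trans (over-zs (λ c → sum (λ i → f i c)))
      (∑-cong xs (λ a → ∑-sum-comm ys (λ i b → f i (h a b))))

    after : ∑ zs (λ _ → sum (λ i → f i (h (x i) (y i)))) ≈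
            ∑ xs (λ _ → ∑ ys (λ _ → sum (λ i → f i (h (x i) (y i)))))
    after = over-zs (λ _ → sum (λ i → f i (h (x i) (y i))))

  -- The first j + 1 entries of a sorted list are all related to the entry at
  -- position j.
  sortedPrefix : ∀ {A : Set} {R : A → A → Set} → (∀ {x} → R x x) → ∀ {xs} → AllPairs R xs →
                 ∀ (j : Fin (length xs)) {a} → a ∈ take (suc (toℕ j)) xs → R a (lookup xs j)
  sortedPrefix refl′ (_ ∷ _)   zero    (here refl) = refl′
  sortedPrefix refl′ (Rx ∷ _)  (suc j) (here refl) = All.lookup Rx (∈-lookup j)
  sortedPrefix refl′ (_ ∷ Rxs) (suc j) (there a∈)    = sortedPrefix refl′ Rxs j a∈

  module _ {A : Set} (g : A → V) where

    private
      decTotalOrder : DecTotalOrder 0ℓ 0ℓ 0ℓ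
      decTotalOrder = Flip.decTotalOrder (On.decTotalOrder (record { isDecTotalOrder = isDecTotalOrder }) g)
      open Sort decTotalOrder using (sort; sort-↭; sort-↗)

    -- The entries of a list, in decreasing order of their values under g.
    descending : List A → List A
    descending = sort

    descending-↭ : ∀ xs → descending xs ↭ xs
    descending-↭ = sort-↭

    descending-sorted : ∀ xs → AllPairs (λ a b → g b ≼ g a) (descending xs)
    descending-sorted xs = Sorted.Sorted⇒AllPairs (DecTotalOrder.totalOrder decTotalOrder) (sort-↗ xs)

  -- Averaging follows if for every family L of enumerations of xs, and for
  -- every position j, some tuple in Sol has its i-th entry among the first
  -- π i j + 1 entries of L i. This is applied to enumerations in decreasing
  -- order of f i. Then f i (x i) is at least the value of f i at position π i j,
  -- and since π i is a permutation, these values run over all of xs with j.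
  levelSets⇒averaging : ∀ {k} {A : Set} (xs : List A) {Sol : (Fin k → A) → Set} →
    0 < length xs → (π : Fin k → Permutation′ (length xs)) →
    (∀ (L : Fin k → List A) → (∀ i → L i ↭ xs) → ∀ j →
      Σ[ x ∈ (Fin k → A) ] Sol x × (∀ i → x i ∈ take (suc (toℕ (π i ⟨$⟩ʳ j))) (L i))) →
    Averaging xs Sol
  levelSets⇒averaging {k} {A} xs@(_ ∷ _) _ π represent f =
    proj₁ (rep best) , proj₁ (proj₂ (rep best)) ,
    ≼-respˡ-≈ (≈-sym total≈) (≼-trans (sum-mono below) (sum-mono (proj₂ best∃)))
    where
    L : Fin k → List A
    L i = descending (f i) xs

    L↭ : ∀ i → L i ↭ xs
    L↭ i = descending-↭ (f i) xs

    rep = represent L L↭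
    best∃ = maximum (λ j → sum (λ i → f i (proj₁ (rep j) i)))
    best = proj₁ best∃

    position : ∀ i → Fin (length xs) → Fin (length (L i))
    position i = subst Fin (sym (↭.↭-length (L↭ i)))

    -- The lower bound of f i on the j-th level set.
    u : Fin k → Fin (length xs) → V
    u i j = f i (lookup (L i) (position i (π i ⟨$⟩ʳ j)))

    sum-subst : ∀ {m n} (eq : m ≡ n) (g : Fin n → V) → sum (λ j → g (subst Fin eq j)) ≈ sum g
    sum-subst refl g = ≈-refl

    total≈ : ∑ xs (λ a → sum (λ i → f i a)) ≈ sum (λ j → sum (λ i → u i j))
    total≈ = begin
      ∑ xs (λ a → sum (λ i → f i a))     ≈⟨ ∑-sum-comm xs f ⟩
      sum (λ i → ∑ xs (f i))             ≈⟨ sum-cong-≋ (λ i → ∑-↭ (f i) (L↭ i)) ⟨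
      sum (λ i → ∑ (L i) (f i))          ≈⟨ sum-cong-≋ (λ i → sum-subst (sym (↭.↭-length (L↭ i))) (λ j → f i (lookup (L i) j))) ⟨
      sum (λ i → sum (λ j → f i (lookup (L i) (position i j))))
                                         ≈⟨ sum-cong-≋ (λ i → sum-permute (λ j → f i (lookup (L i) (position i j))) (π i)) ⟩
      sum (λ i → sum (λ j → u i j))      ≈⟨ ∑-comm u ⟩
      sum (λ j → sum (λ i → u i j))      ∎

    toℕ-subst : ∀ {m n} (eq : m ≡ n) (j : Fin m) → toℕ (subst Fin eq j) ≡ toℕ j
    toℕ-subst refl j = refl

    below : ∀ j → sum (λ i → u i j) ≼ sum (λ i → f i (proj₁ (rep j) i))
    below j = sum-mono λ i → sortedPrefix ≼-refl (descending-sorted (f i) xs) (position i (π i ⟨$⟩ʳ j))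
      (subst (λ m → proj₁ (rep j) i ∈ take (suc m) (L i)) (sym (toℕ-subst (sym (↭.↭-length (L↭ i))) (π i ⟨$⟩ʳ j)))
        (proj₂ (proj₂ (rep j)) i))

-- Sums of nine level sets modulo a prime

private
  module ℕSum = MonoidSums ℕ.+-0-monoid

-- The identity for even i and the reversal of positions for odd i.
alternate : ∀ {k h} → Fin k → Permutation′ h
alternate zero          = Permutation.id
alternate (suc zero)    = Permutation.reverse
alternate (suc (suc i)) = alternate i

toℕ+toℕ-opposite : ∀ {h} (j : Fin h) → toℕ j + suc (toℕ (opposite j)) ≡ h
toℕ+toℕ-opposite {h} j = begin
  toℕ j + suc (toℕ (opposite j))  ≡⟨ ℕ.+-suc (toℕ j) _ ⟩
  suc (toℕ j) + toℕ (opposite j)  ≡⟨ cong (suc (toℕ j) +_) (opposite-prop j) ⟩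
  suc (toℕ j) + (h ∸ suc (toℕ j)) ≡⟨ ℕ.m+[n∸m]≡n (toℕ<n j) ⟩
  h                               ∎
  where open ≡-Reasoning

-- The level sets have j + 1 elements five times and h - j elements four times,
-- which makes 4h + 5 + j in total.
alternate-total : ∀ {h} (j : Fin h) →
  6 + 4 * h ≤ suc (ℕSum.sum (λ (i : Fin 9) → suc (toℕ (alternate i ⟨$⟩ʳ j))))
alternate-total {h} j = begin
  6 + 4 * h                ≤⟨ ℕ.m≤m+n _ a ⟩
  6 + 4 * h + a            ≡⟨ cong (λ t → 6 + 4 * t + a) (toℕ+toℕ-opposite j) ⟨
  6 + 4 * (a + suc b) + a  ≡⟨ solve 2 (λ a b →
    let s = con 1 :+ a ; t = con 1 :+ b in
    con 6 :+ con 4 :* (a :+ t) :+ a :=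
    con 1 :+ (s :+ (t :+ (s :+ (t :+ (s :+ (t :+ (s :+ (t :+ (s :+ con 0))))))))))
    refl a b ⟩
  suc (ℕSum.sum (λ (i : Fin 9) → suc (toℕ (alternate i ⟨$⟩ʳ j)))) ∎
  where
  open ℕ.≤-Reasoning
  open +-*-Solver
  a = toℕ j
  b = toℕ (opposite j)

-- A set H of at least (p + 3) / 4 residue classes, given by a type A whose
-- elements stand for distinct classes.
module LevelSets
  {p : ℕ} .{{_ : NonZero p}} (pr : Prime p)
  {A : Set} (⟦_⟧ : A → ℤ/ p) (⟦⟧-injective : ∀ {x y} → ⟦ x ⟧ ≡ ⟦ y ⟧ → x ≡ y)
  (H : List A) (H! : Unique H) (p+3≤4|H| : p + 3 ≤ 4 * length H)
  where

  open CauchyDavenport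
    (CommutativeRing.+-isAbelianGroup (ℤ/-commutativeRing {p})) Fin._≟_ (ℤ/p-generates pr)

  -- Nine enumerations of H, and a position j which selects an initial segment
  -- of each.
  module _ (L : Fin 9 → List A) (L↭ : ∀ i → L i ↭ H) (j : Fin (length H)) where

    private
      level : Fin 9 → List A
      level i = take (suc (toℕ (alternate i ⟨$⟩ʳ j))) (L i)

      S : Fin 9 → List (ℤ/ p)
      S i = map ⟦_⟧ (level i)

      length-S : ∀ i → length (S i) ≡ suc (toℕ (alternate i ⟨$⟩ʳ j))
      length-S i = begin
        length (S i)                  ≡⟨ length-map ⟦_⟧ (level i) ⟩
        length (level i)              ≡⟨ length-take (suc (toℕ j′)) (L i) ⟩
        suc (toℕ j′) ⊓ length (L i)   ≡⟨ cong (suc (toℕ j′) ⊓_) (↭.↭-length (L↭ i)) ⟩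
        suc (toℕ j′) ⊓ length H       ≡⟨ ℕ.m≤n⇒m⊓n≡m (toℕ<n j′) ⟩
        suc (toℕ j′)                  ∎
        where
        open ≡-Reasoning
        j′ = alternate i ⟨$⟩ʳ j

      S-unique : ∀ i → Unique (S i)
      S-unique i = Unique.map⁺ ⟦⟧-injective
        (Unique.take⁺ (suc (toℕ (alternate i ⟨$⟩ʳ j))) (Unique-resp-↭ (↭.↭-sym (L↭ i)) H!))

      module _ (sumset : LargeIteratedSumset S) where

        open LargeIteratedSumset sumset

        -- The Cauchy-Davenport bound makes 9 + |sums| at least 6 + 4 |H| ≥ 9 + p.
        full : Full sums
        full with large
        ... | inj₁ full = full
        ... | inj₂ le   = unique∧long⇒full unique (ℕ.+-cancelˡ-≤ 9 _ _ (begin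
          9 + p                           ≡⟨ cong (6 +_) (ℕ.+-comm 3 p) ⟩
          6 + (p + 3)                     ≤⟨ ℕ.+-monoʳ-≤ 6 p+3≤4|H| ⟩
          6 + 4 * length H                ≤⟨ alternate-total j ⟩
          suc (ℕSum.sum (λ (i : Fin 9) → suc (toℕ (alternate i ⟨$⟩ʳ j))))
                                          ≡⟨ cong suc (ℕSum.sum-cong-≗ length-S) ⟨
          suc (ℕSum.sum (length ∘ S))     ≤⟨ le ⟩
          9 + length sums                 ∎))
          where open ℕ.≤-Reasoning

        represent : ∀ n → Σ[ x ∈ (Fin 9 → A) ] n ≡ sumₘ (⟦_⟧ ∘ x) × (∀ i → x i ∈ level i)
        represent n with y , y∈ , n≡∑y ← split (full n) =
          proj₁ ∘ preimage , trans n≡∑y (sumₘ-cong (λ i → proj₂ (proj₂ (preimage i)))) ,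
          (λ i → proj₁ (proj₂ (preimage i)))
          where
          preimage : ∀ i → ∃[ r ] r ∈ level i × y i ≡ ⟦ r ⟧
          preimage i = ∈-map⁻ ⟦_⟧ (y∈ i)

    levelSetsRepresent : ∀ n → Σ[ x ∈ (Fin 9 → A) ]
      n ≡ sumₘ (⟦_⟧ ∘ x) × (∀ i → x i ∈ take (suc (toℕ (alternate i ⟨$⟩ʳ j))) (L i))
    levelSetsRepresent = represent
      (largeIteratedSumset S S-unique (λ i → subst (0 <_) (sym (length-S i)) (s≤s z≤n)))

-- Averaging over cubic residues

-- The tuple x of cubic residues has sum n.
Represents : ∀ {k q} .{{_ : NonZero q}} → ℤ/ q → (Fin k → ℤ/ q ⁽³⁾) → Set
Represents n x = n ≡ sumₘ (value ∘ x)

module AveragingCubes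
  (M : CommutativeMonoid 0ℓ 0ℓ)
  {_≼_ : CommutativeMonoid.Carrier M → CommutativeMonoid.Carrier M → Set}
  (isDecTotalOrder : IsDecTotalOrder (CommutativeMonoid._≈_ M) _≼_)
  (∙-mono : ∀ x y z w → x ≼ y → z ≼ w → CommutativeMonoid._∙_ M x z ≼ CommutativeMonoid._∙_ M y w)
  where

  open Averaging M isDecTotalOrder ∙-mono public

  -- Averaging holds for nine cubic residues modulo q with a given sum.
  record CubesAverage (q : ℕ) .{{_ : NonZero q}} : Set where
    field
      averaging : ∀ (n : ℤ/ q) → Averaging {9} (cubicResidues q) (Represents n)
  open CubesAverage

  cubesAverage-prime : ∀ {p} .{{_ : NonZero p}} → Prime p → Coprime p 14 → CubesAverage p
  cubesAverage-prime {p} pr c .averaging n = levelSets⇒averaging (cubicResidues p)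
    (>-nonZero⁻¹ _ {{φ₃-nonZero p}}) alternate
    (λ L L↭ j → LevelSets.levelSetsRepresent pr value value-injective
      (cubicResidues p) (cubicResidues-unique p) (p+3≤4φ₃ p pr c) L L↭ j n)

  -- Modulo 1 all tuples are equal.
  cubesAverage-1 : CubesAverage 1
  cubesAverage-1 .averaging n f = (λ _ → r) , unique n (sumₘ {k = 9} λ _ → value r) , IsDecTotalOrder.reflexive isDecTotalOrder
    (∑-cong (cubicResidues 1) λ a →
      CommutativeMonoid.reflexive M (cong (λ a → sum λ i → f i a) (≡r a)))
    where
    open RawMonoidDefinitions (CommutativeMonoid.rawMonoid M) using (sum)
    unique : (a b : ℤ/ 1) → a ≡ b
    unique zero zero = refl
    r : ℤ/ 1 ⁽³⁾
    r = zero , [ zero , (λ (_ , d∣1) → ∣1⇒≡1 d∣1) , refl ]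
    ≡r : ∀ a → a ≡ r
    ≡r a = value-injective {v = a} {w = r} (unique (value a) zero)

  cubesAverage-* : ∀ {p q} .{{_ : NonZero p}} .{{_ : NonZero q}} .{{_ : NonZero (p * q)}} → Coprime p q →
                   CubesAverage p → CubesAverage q → CubesAverage (p * q)
  cubesAverage-* {p} {q} c avgp avgq .averaging n =
    Averaging-cartesianProduct
      {xs = cubicResidues p} {cubicResidues q} {cubicResidues (p * q) {{p*q-nonZero}}}
      {SolA = Represents (toℕ n mod p)} {Represents (toℕ n mod q)} {Represents {{p*q-nonZero}} n}
      crtResidue cubicResidues-*
      (λ {x} {y} → crt-sumₘ n (value ∘ x) (value ∘ y))
      (avgp .averaging (toℕ n mod p)) (avgq .averaging (toℕ n mod q))
    where open ChineseRemainder {p} {q} c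

  cubesAverage-product : ∀ {ps} → All Prime ps → .{{_ : NonZero (product ps)}} →
                         SquareFree (product ps) → Coprime (product ps) 14 → CubesAverage (product ps)
  cubesAverage-product []                      _  _ = cubesAverage-1
  cubesAverage-product (_∷_ {p} {ps} pr prs) sf c = cubesAverage-* {p} {q} coprime
    (cubesAverage-prime pr λ (d∣p , d∣14) → c (∣m⇒∣m*n q d∣p , d∣14))
    (cubesAverage-product prs (λ d d²∣q → sf d (∣n⇒∣m*n p d²∣q)) λ (d∣q , d∣14) → c (∣n⇒∣m*n p d∣q , d∣14))
    where
    q = product ps
    instance
      p-nonZero : NonZero p
      p-nonZero = prime⇒nonZero pr
      q-nonZero : NonZero q
      q-nonZero = productOfPrimes≢0 prs

    coprime : Coprime p q
    coprime (d∣p , d∣q) with prime⇒irreducible pr d∣p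
    ... | inj₁ d≡1  = d≡1
    ... | inj₂ refl = sf p (*-monoʳ-∣ p d∣q)

  cubesAverage : ∀ q .{{_ : NonZero q}} → SquareFree q → Coprime q 14 → CubesAverage q
  cubesAverage q = go isFactorisation factorsPrime
    where
    open PrimeFactorisation (factorise q)
    go : ∀ {q ps} .{{_ : NonZero q}} → q ≡ product ps → All Prime ps →
         SquareFree q → Coprime q 14 → CubesAverage q
    go refl prs = cubesAverage-product prs

-- The ordered commutative monoid of real numbers

open import Data.Integer.Base as ℤ using (+_)
import Data.Integer.Properties as ℤ
open import Data.Rational.Base as ℚ using (ℚ; mkℚ; 0ℚ; 1ℚ; ½; ∣_∣; _/_)
import Data.Rational.Properties as ℚ
import Data.Rational.Solver as ℚ
import Data.Rational.Unnormalised.Base as ℚᵘ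
import Data.Rational.Unnormalised.Properties as ℚᵘ

private
  ½+½ : ∀ ε → ½ ℚ.* ε ℚ.+ ½ ℚ.* ε ≡ ε
  ½+½ ε = trans (sym (ℚ.*-distribʳ-+ ε ½ ½)) (ℚ.*-identityˡ ε)

  0<r*ε : ∀ r .{{_ : ℚ.Positive r}} {ε} → 0ℚ ℚ.< ε → 0ℚ ℚ.< r ℚ.* ε
  0<r*ε r 0<ε = subst (ℚ._< r ℚ.* _) (ℚ.*-zeroʳ r) (ℚ.*-monoʳ-<-pos r 0<ε)

  p≤p+ε : ∀ p {ε} → 0ℚ ℚ.< ε → p ℚ.≤ p ℚ.+ ε
  p≤p+ε p {ε} 0<ε = subst (ℚ._≤ p ℚ.+ ε) (ℚ.+-identityʳ p) (ℚ.+-monoʳ-≤ p (ℚ.<⇒≤ 0<ε))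

  ∣p-q∣<ε⇒p≤q+ε : ∀ {p q ε} → ∣ p ℚ.- q ∣ ℚ.< ε → p ℚ.≤ q ℚ.+ ε
  ∣p-q∣<ε⇒p≤q+ε {p} {q} {ε} <ε = begin
    p                    ≡⟨ solve 2 (λ p q → p := q :+ (p :- q)) refl p q ⟩
    q ℚ.+ (p ℚ.- q)      ≤⟨ ℚ.+-monoʳ-≤ q (p≤∣p∣ (p ℚ.- q)) ⟩
    q ℚ.+ ∣ p ℚ.- q ∣    ≤⟨ ℚ.+-monoʳ-≤ q (ℚ.<⇒≤ <ε) ⟩
    q ℚ.+ ε              ∎
    where
    open ℚ.≤-Reasoning
    open ℚ.+-*-Solver
    p≤∣p∣ : ∀ p → p ℚ.≤ ∣ p ∣
    p≤∣p∣ p with ℚ.≤-total 0ℚ p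
    ... | inj₁ 0≤p = ℚ.≤-reflexive (sym (ℚ.0≤p⇒∣p∣≡p 0≤p))
    ... | inj₂ p≤0 = ℚ.≤-trans p≤0 (ℚ.0≤∣p∣ p)

pointwise⇒≤ᴿ : ∀ {x y} → (∀ n → seq x n ℚ.≤ seq y n) → x ≤ᴿ y
pointwise⇒≤ᴿ {x} {y} x≤y ε 0<ε = 0 , λ n _ → ℚ.≤-trans (x≤y n) (p≤p+ε (seq y n) 0<ε)

pointwise⇒≈ᴿ : ∀ {x y} → (∀ n → seq x n ≡ seq y n) → x ≈ᴿ y
pointwise⇒≈ᴿ {x} {y} x≡y =
  pointwise⇒≤ᴿ {x} {y} (λ n → ℚ.≤-reflexive (x≡y n)) , pointwise⇒≤ᴿ {y} {x} (λ n → ℚ.≤-reflexive (sym (x≡y n)))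

≤ᴿ-refl : ∀ {x} → x ≤ᴿ x
≤ᴿ-refl {x} = pointwise⇒≤ᴿ {x} {x} (λ _ → ℚ.≤-refl)

≤ᴿ-trans : ∀ {x y z} → x ≤ᴿ y → y ≤ᴿ z → x ≤ᴿ z
≤ᴿ-trans {x} {y} {z} x≤y y≤z ε 0<ε
  with N₁ , xy ← x≤y (½ ℚ.* ε) (0<r*ε ½ 0<ε) | N₂ , yz ← y≤z (½ ℚ.* ε) (0<r*ε ½ 0<ε) =
  N₁ ⊔ N₂ , λ n N≤n → begin
    seq x n                       ≤⟨ xy n (ℕ.m⊔n≤o⇒m≤o N₁ N₂ N≤n) ⟩
    seq y n ℚ.+ ½ ℚ.* ε               ≤⟨ ℚ.+-monoˡ-≤ (½ ℚ.* ε) (yz n (ℕ.m⊔n≤o⇒n≤o N₁ N₂ N≤n)) ⟩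
    seq z n ℚ.+ ½ ℚ.* ε ℚ.+ ½ ℚ.* ε       ≡⟨ ℚ.+-assoc (seq z n) _ _ ⟩
    seq z n ℚ.+ (½ ℚ.* ε ℚ.+ ½ ℚ.* ε)     ≡⟨ cong (seq z n ℚ.+_) (½+½ ε) ⟩
    seq z n ℚ.+ ε                   ∎
  where open ℚ.≤-Reasoning

+ᴿ-mono-≤ᴿ : ∀ x y z w → x ≤ᴿ y → z ≤ᴿ w → (x +ᴿ z) ≤ᴿ (y +ᴿ w)
+ᴿ-mono-≤ᴿ x y z w x≤y z≤w ε 0<ε
  with N₁ , xy ← x≤y (½ ℚ.* ε) (0<r*ε ½ 0<ε) | N₂ , zw ← z≤w (½ ℚ.* ε) (0<r*ε ½ 0<ε) =
  N₁ ⊔ N₂ , λ n N≤n → begin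
    seq x n ℚ.+ seq z n
      ≤⟨ ℚ.+-mono-≤ (xy n (ℕ.m⊔n≤o⇒m≤o N₁ N₂ N≤n)) (zw n (ℕ.m⊔n≤o⇒n≤o N₁ N₂ N≤n)) ⟩
    (seq y n ℚ.+ ½ ℚ.* ε) ℚ.+ (seq w n ℚ.+ ½ ℚ.* ε)
      ≡⟨ solve 3 (λ a b h → (a :+ h) :+ (b :+ h) := a :+ b :+ (h :+ h)) refl (seq y n) (seq w n) (½ ℚ.* ε) ⟩
    seq y n ℚ.+ seq w n ℚ.+ (½ ℚ.* ε ℚ.+ ½ ℚ.* ε)
      ≡⟨ cong (seq y n ℚ.+ seq w n ℚ.+_) (½+½ ε) ⟩
    seq y n ℚ.+ seq w n ℚ.+ ε ∎
  where
  open ℚ.≤-Reasoning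
  open ℚ.+-*-Solver

-- Let the terms of x and y vary by at most δ / 2 from N on. If y m is at most
-- x m for some m from N on, then y is at most x + δ from N on. If there is no
-- such m, then x is below y.
≤ᴿ-total : ExcludedMiddle 0ℓ → ∀ x y → x ≤ᴿ y ⊎ y ≤ᴿ x
≤ᴿ-total em x y with em {x ≤ᴿ y}
... | yes x≤y = inj₁ x≤y
... | no x≰y  = inj₂ y≤x
  where
  y≤x : y ≤ᴿ x
  y≤x δ 0<δ with N₁ , cx ← cauchy x (½ ℚ.* δ) (0<r*ε ½ 0<δ) | N₂ , cy ← cauchy y (½ ℚ.* δ) (0<r*ε ½ 0<δ)
    with em {∃[ m ] N₁ ⊔ N₂ ≤ m × seq y m ℚ.≤ seq x m}
  ... | yes (m , N≤m , ym≤xm) = N₁ ⊔ N₂ , λ n N≤n → begin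
    seq y n                               ≤⟨ ∣p-q∣<ε⇒p≤q+ε {seq y n} {seq y m} (cy n m (ℕ.m⊔n≤o⇒n≤o N₁ N₂ N≤n) (ℕ.m⊔n≤o⇒n≤o N₁ N₂ N≤m)) ⟩
    seq y m ℚ.+ ½ ℚ.* δ                   ≤⟨ ℚ.+-monoˡ-≤ (½ ℚ.* δ) ym≤xm ⟩
    seq x m ℚ.+ ½ ℚ.* δ                   ≤⟨ ℚ.+-monoˡ-≤ (½ ℚ.* δ) (∣p-q∣<ε⇒p≤q+ε {seq x m} {seq x n} (cx m n (ℕ.m⊔n≤o⇒m≤o N₁ N₂ N≤m) (ℕ.m⊔n≤o⇒m≤o N₁ N₂ N≤n))) ⟩
    seq x n ℚ.+ ½ ℚ.* δ ℚ.+ ½ ℚ.* δ       ≡⟨ ℚ.+-assoc (seq x n) _ _ ⟩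
    seq x n ℚ.+ (½ ℚ.* δ ℚ.+ ½ ℚ.* δ)     ≡⟨ cong (seq x n ℚ.+_) (½+½ δ) ⟩
    seq x n ℚ.+ δ                         ∎
    where open ℚ.≤-Reasoning
  ... | no none = contradiction
    (λ ε 0<ε → N₁ ⊔ N₂ , λ n N≤n → ℚ.≤-trans
      (ℚ.<⇒≤ (ℚ.≰⇒> (λ yn≤xn → none (n , N≤n , yn≤xn)))) (p≤p+ε (seq y n) 0<ε))
    x≰y

ℝ-commutativeMonoid : CommutativeMonoid 0ℓ 0ℓ
ℝ-commutativeMonoid = record
  { Carrier = ℝ ; _≈_ = _≈ᴿ_ ; _∙_ = _+ᴿ_ ; ε = 0ᴿ
  ; isCommutativeMonoid = record
    { isMonoid = record
      { isSemigroup = record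
        { isMagma = record
          { isEquivalence = record
            { refl = λ {x} → ≤ᴿ-refl {x} , ≤ᴿ-refl {x}
            ; sym = swap
            ; trans = λ {x} {y} {z} (x≤y , y≤x) (y≤z , z≤y) →
                ≤ᴿ-trans {x} {y} {z} x≤y y≤z , ≤ᴿ-trans {z} {y} {x} z≤y y≤x }
          ; ∙-cong = λ {x} {y} {z} {w} (x≤y , y≤x) (z≤w , w≤z) →
              +ᴿ-mono-≤ᴿ x y z w x≤y z≤w , +ᴿ-mono-≤ᴿ y x w z y≤x w≤z }
        ; assoc = λ x y z → pointwise⇒≈ᴿ {(x +ᴿ y) +ᴿ z} {x +ᴿ (y +ᴿ z)} λ n → ℚ.+-assoc (seq x n) _ _ }
      ; identity = (λ x → pointwise⇒≈ᴿ {0ᴿ +ᴿ x} {x} λ n → ℚ.+-identityˡ (seq x n)) ,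
                   (λ x → pointwise⇒≈ᴿ {x +ᴿ 0ᴿ} {x} λ n → ℚ.+-identityʳ (seq x n)) }
    ; comm = λ x y → pointwise⇒≈ᴿ {x +ᴿ y} {y +ᴿ x} λ n → ℚ.+-comm (seq x n) _ } }

≤ᴿ-isDecTotalOrder : ExcludedMiddle 0ℓ → IsDecTotalOrder _≈ᴿ_ _≤ᴿ_
≤ᴿ-isDecTotalOrder em = record
  { isTotalOrder = record
    { isPartialOrder = record
      { isPreorder = record
        { isEquivalence = CommutativeMonoid.isEquivalence ℝ-commutativeMonoid
        ; reflexive = proj₁
        ; trans = λ {x} {y} {z} → ≤ᴿ-trans {x} {y} {z} }
      ; antisym = _,_ }
    ; total = ≤ᴿ-total em }
  ; _≟_ = λ _ _ → em
  ; _≤?_ = λ _ _ → em }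

·ᴿ-mono-≤ᴿ : ∀ r .{{_ : ℚ.Positive r}} {x y} → x ≤ᴿ y → (r ·ᴿ x) ≤ᴿ (r ·ᴿ y)
·ᴿ-mono-≤ᴿ r {x} {y} x≤y ε 0<ε = proj₁ x≤y′ , λ n N≤n → begin
  r ℚ.* seq x n                       ≤⟨ ℚ.*-monoˡ-≤-nonNeg r {{ℚ.pos⇒nonNeg r}} (proj₂ x≤y′ n N≤n) ⟩
  r ℚ.* (seq y n ℚ.+ r⁻¹ ℚ.* ε)           ≡⟨ ℚ.*-distribˡ-+ r (seq y n) _ ⟩
  r ℚ.* seq y n ℚ.+ r ℚ.* (r⁻¹ ℚ.* ε)       ≡⟨ cong (r ℚ.* seq y n ℚ.+_) (trans (sym (ℚ.*-assoc r r⁻¹ ε))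
                                         (trans (cong (ℚ._* ε) (ℚ.*-inverseʳ r)) (ℚ.*-identityˡ ε))) ⟩
  r ℚ.* seq y n ℚ.+ ε                   ∎
  where
  open ℚ.≤-Reasoning
  instance
    r-nonZero : ℚ.NonZero r
    r-nonZero = ℚ.pos⇒nonZero r
  r⁻¹ = ℚ.1/ r
  x≤y′ = x≤y (r⁻¹ ℚ.* ε) (0<r*ε r⁻¹ {{ℚ.1/pos⇒pos r}} 0<ε)

private
  -- The rational number n / 1, in lowest terms by construction.
  natℚ : ℕ → ℚ
  natℚ n = mkℚ (+ n) 0 (Coprimality.sym (Coprimality.1-coprimeTo n))

  natℚ-suc : ∀ n → natℚ (suc n) ≡ 1ℚ ℚ.+ natℚ n
  natℚ-suc n = trans (sym (ℚ.↥p/↧p≡p (natℚ (suc n)))) (cong (_/ 1) (sym (cong (ℤ._+_ (+ 1)) (ℤ.*-identityʳ (+ n)))))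

  1/n*n≡1 : ∀ n .{{_ : NonZero n}} → (+ 1 / n) ℚ.* natℚ n ≡ 1ℚ
  1/n*n≡1 n@(suc m) = ℚ.toℚᵘ-injective (begin
    ℚ.toℚᵘ ((+ 1 / n) ℚ.* natℚ n)              ≈⟨ ℚ.toℚᵘ-homo-* (+ 1 / n) (natℚ n) ⟩
    ℚ.toℚᵘ (+ 1 / n) ℚᵘ.* ℚ.toℚᵘ (natℚ n)      ≈⟨ ℚᵘ.*-congʳ {ℚ.toℚᵘ (natℚ n)} (ℚ.toℚᵘ-fromℚᵘ (ℚᵘ.mkℚᵘ (+ 1) m)) ⟩
    ℚᵘ.mkℚᵘ (+ 1) m ℚᵘ.* ℚᵘ.mkℚᵘ (+ n) 0       ≈⟨ ℚᵘ.*≡* (cong +_ (cong suc (lemma m))) ⟩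
    ℚ.toℚᵘ 1ℚ                                  ∎)
    where
    open ℚᵘ.≃-Reasoning
    lemma : ∀ m → (m + 0) * 1 ≡ m * 1 + 0
    lemma m = trans (cong (_* 1) (ℕ.+-identityʳ m)) (sym (ℕ.+-identityʳ (m * 1)))

seq-sum-constant : ∀ k x n → seq (sumᴿ {k} (λ _ → x)) n ≡ natℚ k ℚ.* seq x n
seq-sum-constant zero    x n = sym (ℚ.*-zeroˡ (seq x n))
seq-sum-constant (suc k) x n = begin
  seq x n ℚ.+ seq (sumᴿ {k} (λ _ → x)) n     ≡⟨ cong (seq x n ℚ.+_) (seq-sum-constant k x n) ⟩
  seq x n ℚ.+ natℚ k ℚ.* seq x n             ≡⟨ cong (ℚ._+ natℚ k ℚ.* seq x n) (ℚ.*-identityˡ (seq x n)) ⟨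
  1ℚ ℚ.* seq x n ℚ.+ natℚ k ℚ.* seq x n      ≡⟨ ℚ.*-distribʳ-+ (seq x n) 1ℚ (natℚ k) ⟨
  (1ℚ ℚ.+ natℚ k) ℚ.* seq x n                ≡⟨ cong (ℚ._* seq x n) (natℚ-suc k) ⟨
  natℚ (suc k) ℚ.* seq x n                   ∎
  where open ≡-Reasoning

average-constant : ∀ k .{{_ : NonZero k}} x → ((+ 1 / k) ·ᴿ sumᴿ {k} (λ _ → x)) ≈ᴿ x
average-constant k x = pointwise⇒≈ᴿ {(+ 1 / k) ·ᴿ sumᴿ {k} (λ _ → x)} {x} λ n → begin
  (+ 1 / k) ℚ.* seq (sumᴿ {k} (λ _ → x)) n   ≡⟨ cong ((+ 1 / k) ℚ.*_) (seq-sum-constant k x n) ⟩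
  (+ 1 / k) ℚ.* (natℚ k ℚ.* seq x n)         ≡⟨ ℚ.*-assoc (+ 1 / k) (natℚ k) _ ⟨
  (+ 1 / k) ℚ.* natℚ k ℚ.* seq x n           ≡⟨ cong (ℚ._* seq x n) (1/n*n≡1 k) ⟩
  1ℚ ℚ.* seq x n                             ≡⟨ ℚ.*-identityˡ (seq x n) ⟩
  seq x n                                    ∎
  where open ≡-Reasoning

module _ (em : ExcludedMiddle 0ℓ) where

  open AveragingCubes ℝ-commutativeMonoid (≤ᴿ-isDecTotalOrder em) +ᴿ-mono-≤ᴿ
    using (Averaging; module CubesAverage; cubesAverage) public

  -- Division of the averaging property by the number of entries of xs.
  averaging⇒average : ∀ {k} {A : Set} (xs : List A) {Sol : (Fin k → A) → Set} → Averaging xs Sol →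
    ∀ {size} .{{_ : NonZero size}} → size ≡ length xs → (f : Fin k → A → ℝ) →
    ∀ {total} → total ≡ sumᴿ (λ j → sumᴿ (λ i → f i (Vec.fromList xs j))) →
    Σ[ x ∈ (Fin k → A) ] Sol x × sumᴿ (λ i → f i (x i)) ≥ᴿ (+ 1 / size) ·ᴿ total
  averaging⇒average xs avg refl f refl with x , sol , total≤ ← avg f =
    x , sol , divide (length xs)
      {sumᴿ (λ j → sumᴿ (λ i → f i (Vec.fromList xs j)))} {sumᴿ (λ i → f i (x i))} total≤
    where
    divide : ∀ k .{{_ : NonZero k}} {y z} → y ≤ᴿ sumᴿ {k} (λ _ → z) → ((+ 1 / k) ·ᴿ y) ≤ᴿ z
    divide k {y} {z} y≤kz =
      ≤ᴿ-trans {(+ 1 / k) ·ᴿ y} {(+ 1 / k) ·ᴿ sumᴿ {k} (λ _ → z)} {z}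
        (·ᴿ-mono-≤ᴿ (+ 1 / k) {{ℚ.normalize-pos 1 k}} {y} {sumᴿ {k} (λ _ → z)} y≤kz)
        (proj₁ (average-constant k z))

theorem1p3 : ExcludedMiddle 0ℓ →
    (q : ℕ) .{{_ : NonZero q}} → SquareFree q → Coprime q 14 →
    (f : Fin 9 → ℤ/ q ⁽³⁾ → ℝ) →
    (n : ℤ/ q) →
    Σ[ x ∈ (Fin 9 → ℤ/ q ⁽³⁾) ]
    n ≡ sumₘ (λ i → value (x i))
    × sumᴿ (λ i → f i (x i))
    ≥ᴿ (+ 1 / φ₃ q) {{φ₃-nonZero q}} ·ᴿ (∑[ a ∈ℤ/ q ⁽³⁾] sumᴿ (λ i → f i a))
theorem1p3 em q sf coprime f n =
  averaging⇒average em (cubicResidues q) {Represents n}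
    (CubesAverage.averaging (cubesAverage em q sf coprime) n)
    {φ₃ q} {{φ₃-nonZero q}} refl f {∑[ a ∈ℤ/ q ⁽³⁾] sumᴿ (λ i → f i a)} refl
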